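{- Let $G$ be a connected metric graph with $\ell(G)$ leaves, cyclomatic number $\mathrm{cyc}(G)$, total length $\mathrm{len}(G)$ and radius $\mathrm{radius}(G)$. Then $$\mathrm{len}(G) \le \big(2\,\mathrm{cyc}(G) + \ell(G)\big)\cdot \mathrm{radius}(G).$$
   Context: A metric graph is the compact metric space obtained from a finite collection of compact intervals (edges) of positive length by identifying their endpoints in groups (the vertices); equivalently, it is a finite edge-weighted multigraph (loops and parallel edges allowed) in which all points in the interior of each edge are included and each edge is locally isometric to an interval whose length is the edge weight. Metric graphs are assumed connected. The distance $d_G(x,y)$ is the minimum length of a path in $G$ from $x$ to $y$. The radius is $\mathrm{radius}(G)=\min_{x\in G}\max_{y\in G} d_G(x,y)$, over all points of $G$ (not only vertices). The length $\mathrm{len}(G)$ is the sum of the lengths of the edges. A leaf is a vertex of degree one (a point having a small neighborhood homeomorphic to an interval with that point as an endpoint), and $\ell(G)$ is the number of leaves. The cyclomatic number is $\mathrm{cyc}(G)=|E|-|V|+1$ for any combinatorial graph $(V,E)$ describing $G$ (equivalently the first Betti number of $G$). -}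

module Defs where

open import Algebra.Bundles using (RawMonoid)
open import Algebra.Definitions.RawMonoid using (sum) renaming (_×_ to multiple)
open import Data.Fin.Base using (Fin)
import Data.Fin.Properties as Fin
open import Data.Integer.Base as ℤ using (ℤ; +_; -[1+_])
open import Data.Nat.Base as ℕ using (ℕ; NonZero)
import Data.Nat.Properties as ℕ
open import Data.Product.Base using (Σ; ∃-syntax; _×_; _,_)
open import Data.Rational.Base as ℚ using (ℚ; 0ℚ; ½)
import Data.Rational.Properties as ℚ
open import Data.Rational.Solver using (module +-*-Solver)
open import Data.Sum.Base using (inj₁; inj₂)
open import Data.Vec.Base using (allFin; count)
open import Relation.Binary.Construct.Closure.Equivalence using (EqClosure)
open import Relation.Binary.Construct.Closure.ReflexiveTransitive using (ε; _◅_)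
open import Relation.Binary.Construct.Closure.Symmetric using (fwd; bwd)
open import Relation.Binary.PropositionalEquality
  using (_≡_; refl; sym; trans; cong; subst)

------------------------------------------------------------------------
-- Real numbers: Cauchy sequences of rationals, carrying their modulus of
-- convergence, and considered up to the equivalence _≃_ below.

Cauchy : (ℕ → ℚ) → Set
Cauchy x = ∀ δ → 0ℚ ℚ.< δ →
  ∃[ N ] ∀ m n → N ℕ.≤ m → N ℕ.≤ n → ℚ.∣ x m ℚ.- x n ∣ ℚ.≤ δ

record ℝ : Set where
  constructor mkℝ
  field
    seq    : ℕ → ℚ
    cauchy : Cauchy seq

open ℝ public

infix 4 _≤_ _<_ _≃_

_≤_ : ℝ → ℝ → Set
x ≤ y = ∀ δ → 0ℚ ℚ.< δ → ∃[ N ] ∀ n → N ℕ.≤ n → seq x n ℚ.≤ seq y n ℚ.+ δ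

_<_ : ℝ → ℝ → Set
x < y = ∃[ δ ] 0ℚ ℚ.< δ × ∃[ N ] ∀ n → N ℕ.≤ n → seq x n ℚ.+ δ ℚ.≤ seq y n

_≃_ : ℝ → ℝ → Set
x ≃ y = x ≤ y × y ≤ x

private
  module S = +-*-Solver

  0<½δ : ∀ {δ} → 0ℚ ℚ.< δ → 0ℚ ℚ.< ½ ℚ.* δ
  0<½δ {δ} 0<δ = subst (ℚ._< ½ ℚ.* δ) (ℚ.*-zeroʳ ½) (ℚ.*-monoʳ-<-pos ½ 0<δ)

  ½δ+½δ≡δ : ∀ δ → ½ ℚ.* δ ℚ.+ ½ ℚ.* δ ≡ δ
  ½δ+½δ≡δ δ = trans (sym (ℚ.*-distribʳ-+ δ ½ ½)) (ℚ.*-identityˡ δ)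

  +-minus-+ : ∀ a b c d → (a ℚ.+ b) ℚ.- (c ℚ.+ d) ≡ (a ℚ.- c) ℚ.+ (b ℚ.- d)
  +-minus-+ = S.solve 4 (λ a b c d →
    (a S.:+ b) S.:- (c S.:+ d) S.:= (a S.:- c) S.:+ (b S.:- d)) refl

  neg-minus : ∀ a b → ℚ.- a ℚ.- (ℚ.- b) ≡ ℚ.- (a ℚ.- b)
  neg-minus = S.solve 2 (λ a b →
    S.:- a S.:- (S.:- b) S.:= S.:- (a S.:- b)) refl

  swap-minus : ∀ a b → ℚ.- (a ℚ.- b) ≡ b ℚ.- a
  swap-minus = S.solve 2 (λ a b → S.:- (a S.:- b) S.:= b S.:- a) refl

  minus-plus : ∀ a b → (a ℚ.- b) ℚ.+ b ≡ a
  minus-plus = S.solve 2 (λ a b → (a S.:- b) S.:+ b S.:= a) refl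

  plus-minus : ∀ a b → (a ℚ.+ b) ℚ.- b ≡ a
  plus-minus = S.solve 2 (λ a b → (a S.:+ b) S.:- b S.:= a) refl

  ∣a∣-∣b∣≤∣a-b∣ : ∀ a b → ℚ.∣ a ∣ ℚ.- ℚ.∣ b ∣ ℚ.≤ ℚ.∣ a ℚ.- b ∣
  ∣a∣-∣b∣≤∣a-b∣ a b = begin
    ℚ.∣ a ∣ ℚ.- ℚ.∣ b ∣
      ≡⟨ cong (λ z → ℚ.∣ z ∣ ℚ.- ℚ.∣ b ∣) (minus-plus a b) ⟨
    ℚ.∣ (a ℚ.- b) ℚ.+ b ∣ ℚ.- ℚ.∣ b ∣
      ≤⟨ ℚ.+-monoˡ-≤ (ℚ.- ℚ.∣ b ∣) (ℚ.∣p+q∣≤∣p∣+∣q∣ (a ℚ.- b) b) ⟩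
    (ℚ.∣ a ℚ.- b ∣ ℚ.+ ℚ.∣ b ∣) ℚ.- ℚ.∣ b ∣
      ≡⟨ plus-minus ℚ.∣ a ℚ.- b ∣ ℚ.∣ b ∣ ⟩
    ℚ.∣ a ℚ.- b ∣ ∎
    where open ℚ.≤-Reasoning

  ∣∣a∣-∣b∣∣≤∣a-b∣ : ∀ a b → ℚ.∣ ℚ.∣ a ∣ ℚ.- ℚ.∣ b ∣ ∣ ℚ.≤ ℚ.∣ a ℚ.- b ∣
  ∣∣a∣-∣b∣∣≤∣a-b∣ a b with ℚ.∣p∣≡p∨∣p∣≡-p (ℚ.∣ a ∣ ℚ.- ℚ.∣ b ∣)
  ... | inj₁ eq = subst (ℚ._≤ ℚ.∣ a ℚ.- b ∣) (sym eq) (∣a∣-∣b∣≤∣a-b∣ a b)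
  ... | inj₂ eq = begin
    ℚ.∣ ℚ.∣ a ∣ ℚ.- ℚ.∣ b ∣ ∣  ≡⟨ trans eq (swap-minus ℚ.∣ a ∣ ℚ.∣ b ∣) ⟩
    ℚ.∣ b ∣ ℚ.- ℚ.∣ a ∣        ≤⟨ ∣a∣-∣b∣≤∣a-b∣ b a ⟩
    ℚ.∣ b ℚ.- a ∣              ≡⟨ cong ℚ.∣_∣ (swap-minus a b) ⟨
    ℚ.∣ ℚ.- (a ℚ.- b) ∣        ≡⟨ ℚ.∣-p∣≡∣p∣ (a ℚ.- b) ⟩
    ℚ.∣ a ℚ.- b ∣              ∎
    where open ℚ.≤-Reasoning

0ℝ : ℝ
0ℝ = mkℝ (λ _ → 0ℚ) (λ δ 0<δ → 0 , λ _ _ _ _ → ℚ.<⇒≤ 0<δ)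

infixl 6 _+_ _-_
infix  8 -_

_+_ : ℝ → ℝ → ℝ
x + y = mkℝ (λ n → seq x n ℚ.+ seq y n) cauchy-+
  where
  cauchy-+ : Cauchy (λ n → seq x n ℚ.+ seq y n)
  cauchy-+ δ 0<δ
    with M , p ← cauchy x (½ ℚ.* δ) (0<½δ 0<δ)
       | N , q ← cauchy y (½ ℚ.* δ) (0<½δ 0<δ)
    = M ℕ.⊔ N , λ m n M⊔N≤m M⊔N≤n →
      let a = seq x m ℚ.- seq x n
          b = seq y m ℚ.- seq y n
      in begin
        ℚ.∣ (seq x m ℚ.+ seq y m) ℚ.- (seq x n ℚ.+ seq y n) ∣
          ≡⟨ cong ℚ.∣_∣ (+-minus-+ (seq x m) (seq y m) (seq x n) (seq y n)) ⟩
        ℚ.∣ a ℚ.+ b ∣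
          ≤⟨ ℚ.∣p+q∣≤∣p∣+∣q∣ a b ⟩
        ℚ.∣ a ∣ ℚ.+ ℚ.∣ b ∣
          ≤⟨ ℚ.+-mono-≤
               (p m n (ℕ.m⊔n≤o⇒m≤o M N M⊔N≤m) (ℕ.m⊔n≤o⇒m≤o M N M⊔N≤n))
               (q m n (ℕ.m⊔n≤o⇒n≤o M N M⊔N≤m) (ℕ.m⊔n≤o⇒n≤o M N M⊔N≤n)) ⟩
        ½ ℚ.* δ ℚ.+ ½ ℚ.* δ
          ≡⟨ ½δ+½δ≡δ δ ⟩
        δ ∎
    where open ℚ.≤-Reasoning

-_ : ℝ → ℝ
- x = mkℝ (λ n → ℚ.- seq x n) λ δ 0<δ →
  let N , p = cauchy x δ 0<δ in
  N , λ m n N≤m N≤n → subst (ℚ._≤ δ)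
    (sym (trans (cong ℚ.∣_∣ (neg-minus (seq x m) (seq x n)))
                (ℚ.∣-p∣≡∣p∣ (seq x m ℚ.- seq x n))))
    (p m n N≤m N≤n)

_-_ : ℝ → ℝ → ℝ
x - y = x + (- y)

∣_∣ : ℝ → ℝ
∣ x ∣ = mkℝ (λ n → ℚ.∣ seq x n ∣) λ δ 0<δ →
  let N , p = cauchy x δ 0<δ in
  N , λ m n N≤m N≤n →
    ℚ.≤-trans (∣∣a∣-∣b∣∣≤∣a-b∣ (seq x m) (seq x n)) (p m n N≤m N≤n)

+-0-rawMonoid : RawMonoid _ _
+-0-rawMonoid = record { Carrier = ℝ ; _≈_ = _≃_ ; _∙_ = _+_ ; ε = 0ℝ }

infixr 7 _·_

-- Product of an integer and a real.
_·_ : ℤ → ℝ → ℝ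
(+ n)    · x = multiple +-0-rawMonoid n x
-[1+ n ] · x = - (multiple +-0-rawMonoid (ℕ.suc n) x)

IsMinimum : (ℝ → Set) → ℝ → Set
IsMinimum P m = P m × (∀ z → P z → m ≤ z)

IsMaximum : (ℝ → Set) → ℝ → Set
IsMaximum P m = P m × (∀ z → P z → z ≤ m)

------------------------------------------------------------------------
-- Metric graphs, presented by a finite connected multigraph (loops and
-- parallel edges allowed) with positive edge lengths.  The edge e is the
-- interval [0, len e], with 0 glued to src e and len e glued to tgt e;
-- the choice of direction is immaterial.

record MetricGraph : Set where
  field
    ∣V∣ ∣E∣   : ℕ
    src tgt   : Fin ∣E∣ → Fin ∣V∣
    len       : Fin ∣E∣ → ℝ
    len>0     : ∀ e → 0ℝ < len e
    nonempty  : NonZero ∣V∣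
    connected : ∀ u v → EqClosure (λ a b → ∃[ e ] src e ≡ a × tgt e ≡ b) u v

module _ (G : MetricGraph) where
  open MetricGraph G

  totalLength : ℝ
  totalLength = sum +-0-rawMonoid len

  -- A loop contributes two to the degree of its vertex.
  degree : Fin ∣V∣ → ℕ
  degree v = count (λ e → src e Fin.≟ v) (allFin ∣E∣)
       ℕ.+ count (λ e → tgt e Fin.≟ v) (allFin ∣E∣)

  leaves : ℕ
  leaves = count (λ v → degree v ℕ.≟ 1) (allFin ∣V∣)

  cyc : ℤ
  cyc = + ∣E∣ ℤ.- + ∣V∣ ℤ.+ + 1

  -- The disjoint union of the vertices and of the closed edges.  The points
  -- of the metric space are the classes of these under the gluing; all the
  -- notions below are invariant under it, as glued points are joined by a
  -- path of length zero.
  data Point : Set where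
    vertex : Fin ∣V∣ → Point
    on     : ∀ e t → 0ℝ ≤ t → t ≤ len e → Point

  data Step : Point → Point → Set where
    segment  : ∀ e s t {s≥0 s≤len t≥0 t≤len} →
               Step (on e s s≥0 s≤len) (on e t t≥0 t≤len)
    glue-src : ∀ e t {t≥0 t≤len} → t ≃ 0ℝ →
               Step (on e t t≥0 t≤len) (vertex (src e))
    glue-tgt : ∀ e t {t≥0 t≤len} → t ≃ len e →
               Step (on e t t≥0 t≤len) (vertex (tgt e))

  stepLength : ∀ {x y} → Step x y → ℝ
  stepLength (segment e s t) = ∣ s - t ∣
  stepLength (glue-src _ _ _) = 0ℝ
  stepLength (glue-tgt _ _ _) = 0ℝ

  -- Paths run through finitely many segments of edges, in either direction.
  Path : Point → Point → Set
  Path = EqClosure Step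

  pathLength : ∀ {x y} → Path x y → ℝ
  pathLength ε           = 0ℝ
  pathLength (fwd s ◅ p) = stepLength s + pathLength p
  pathLength (bwd s ◅ p) = stepLength s + pathLength p

  IsDistance : Point → Point → ℝ → Set
  IsDistance x y = IsMinimum (λ l → Σ (Path x y) λ p → pathLength p ≃ l)

  IsEccentricity : Point → ℝ → Set
  IsEccentricity x = IsMaximum (λ d → ∃[ y ] IsDistance x y d)

  IsRadius : ℝ → Set
  IsRadius = IsMinimum (λ m → ∃[ x ] IsEccentricity x m)

{-# OPTIONS --safe #-}

-- Let x be a point of eccentricity r, the radius, and a v the distance from x
-- to the vertex v.  Cutting an edge at x leaves ∣E∣ + 1 edges and adds x to the
-- vertices.  On an edge of length c between u and v, the farthest point from x
-- is at distance (a u + a v + c) / 2, so its slack 2r - a u - a v - c is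
-- nonnegative.  The last edge of a shortest path from x to v has slack
-- 2r - 2 (a v), and it determines v as lengths are positive, whence
--   Σ_v (2r - 2 (a v)) ≤ Σ_e slack e = 2r (∣E∣ + 1) - Σ_v deg v · a v - len G.
-- A vertex v has degree at least two or is a leaf with a v ≤ r, so that
--   Σ_v 2 (a v) ≤ Σ_v deg v · a v + ℓ(G) r,
-- and the sum of the two is the claim.
--
-- Constructively, shortest paths exist only up to double negation; this
-- suffices because ≤ on the reals is stable under it.

module Submission where

open import Defs
open import Data.Integer.Base using (+_) renaming (_+_ to _+ℤ_; _*_ to _*ℤ_)
open import Algebra.Bundles using (CommutativeMonoid)
open import Algebra.Definitions.RawMonoid using (sum) renaming (_×_ to multiple)
open import Algebra.Properties.CommutativeSemigroup using (interchange)
open import Algebra.Properties.Group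
  using (\\-leftDividesʳ; identityˡ-unique; x∙y⁻¹≈ε⇒x≈y; ⁻¹-anti-homo-//)
open import Algebra.Properties.Monoid.Mult using (×-homo-+)
open import Data.Bool.Base using (if_then_else_)
open import Data.Fin.Base using (Fin; zero; suc)
import Data.Fin.Properties as Fin
open import Data.Integer.Base as ℤ using (-[1+_]; _⊖_)
import Data.Integer.Properties as ℤ
open import Data.Integer.Solver using () renaming (module +-*-Solver to Z)
open import Data.List.Base using (List; []; _∷_)
open import Data.Nat.Base as ℕ using (ℕ; zero; suc)
import Data.Nat.Properties as ℕ
open import Data.Product.Base using (Σ; ∃-syntax; _×_; _,_; proj₁; proj₂)
open import Data.Rational.Base as ℚ using (ℚ; 0ℚ; ½)
import Data.Rational.Properties as ℚ
import Data.Rational.Unnormalised.Base as ℚᵘ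
import Data.Rational.Unnormalised.Properties as ℚᵘ
open import Data.Sum.Base using (_⊎_; inj₁; inj₂; [_,_]′)
open import Data.Unit.Base using (⊤; tt)
open import Data.Vec.Base as Vec using (Vec; []; _∷_)
import Data.Vec.Functional as Vector
open import Data.Vec.N-ary using (N-ary; _$ⁿ_)
open import Data.Vec.Properties using (lookup-map)
open import Effect.Monad using (RawMonad)
open import Function.Base using (_∘_; id)
open import Level using (0ℓ)
open import Relation.Binary.Construct.Closure.Equivalence using (EqClosure)
open import Relation.Binary.Construct.Closure.ReflexiveTransitive using (ε; _◅_; _◅◅_)
open import Relation.Binary.Construct.Closure.Symmetric using (fwd; bwd)
open import Relation.Binary.PropositionalEquality
  using (_≡_; _≢_; refl; sym; trans; cong; cong₂; subst; subst₂; module ≡-Reasoning)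
open import Relation.Nullary using (¬_; Dec; yes; no; does; contradiction)
open import Relation.Nullary.Negation using (¬¬-Monad; ¬¬-map)
open import Relation.Unary using (Pred; Decidable; _⊆_; _∪_)

-- Linear arithmetic by reflection

infixl 6 _⊕_ _⊝_
infix  5.5 _≼_
infix  3 _⊢_

data Term (k : ℕ) : Set where
  var     : Fin k → Term k
  𝟘       : Term k
  _⊕_ _⊝_ : Term k → Term k → Term k

data Inequality (k : ℕ) : Set where
  _≼_ : Term k → Term k → Inequality k

data Entailment (k : ℕ) : Set where
  _⊢_ : List (Inequality k) → Inequality k → Entailment k

⟦_⟧ : ∀ {k} → Term k → Vec ℚ k → ℚ
⟦ var i ⟧ ρ = Vec.lookup ρ i
⟦ 𝟘 ⟧     ρ = 0ℚ
⟦ s ⊕ t ⟧ ρ = ⟦ s ⟧ ρ ℚ.+ ⟦ t ⟧ ρ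
⟦ s ⊝ t ⟧ ρ = ⟦ s ⟧ ρ ℚ.- ⟦ t ⟧ ρ

-- Natural rather than rational coefficients, as closed rationals are slow to
-- normalise.
positive negative : ∀ {k} → Term k → Vec ℕ k
positive (var i) = Vec.replicate _ 0 Vec.[ i ]≔ 1
positive 𝟘       = Vec.replicate _ 0
positive (s ⊕ t) = Vec.zipWith ℕ._+_ (positive s) (positive t)
positive (s ⊝ t) = Vec.zipWith ℕ._+_ (positive s) (negative t)
negative (var i) = Vec.replicate _ 0
negative 𝟘       = Vec.replicate _ 0
negative (s ⊕ t) = Vec.zipWith ℕ._+_ (negative s) (negative t)
negative (s ⊝ t) = Vec.zipWith ℕ._+_ (negative s) (positive t)

_×ℚ_ : ℕ → ℚ → ℚ
_×ℚ_ = multiple ℚ.+-0-rawMonoid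

dot : ∀ {k} → Vec ℕ k → Vec ℚ k → ℚ
dot []      []      = 0ℚ
dot (c ∷ u) (q ∷ ρ) = c ×ℚ q ℚ.+ dot u ρ

dot-zero : ∀ {k} (ρ : Vec ℚ k) → dot (Vec.replicate k 0) ρ ≡ 0ℚ
dot-zero []      = refl
dot-zero (q ∷ ρ) = trans (ℚ.+-identityˡ _) (dot-zero ρ)

dot-unit : ∀ {k} (i : Fin k) (ρ : Vec ℚ k) →
  dot (Vec.replicate k 0 Vec.[ i ]≔ 1) ρ ≡ Vec.lookup ρ i
dot-unit zero    (q ∷ ρ) = trans (cong₂ ℚ._+_ (ℚ.+-identityʳ q) (dot-zero ρ)) (ℚ.+-identityʳ q)
dot-unit (suc i) (q ∷ ρ) = trans (ℚ.+-identityˡ _) (dot-unit i ρ)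

ℚ-medial : ∀ a b c d → (a ℚ.+ b) ℚ.+ (c ℚ.+ d) ≡ (a ℚ.+ c) ℚ.+ (b ℚ.+ d)
ℚ-medial = interchange (CommutativeMonoid.commutativeSemigroup ℚ.+-0-commutativeMonoid)

dot-+ : ∀ {k} (u v : Vec ℕ k) ρ → dot (Vec.zipWith ℕ._+_ u v) ρ ≡ dot u ρ ℚ.+ dot v ρ
dot-+ []      []      []      = refl
dot-+ (c ∷ u) (d ∷ v) (q ∷ ρ) = trans (cong₂ ℚ._+_ (×-homo-+ ℚ.+-0-monoid q c d) (dot-+ u v ρ))
  (ℚ-medial (c ×ℚ q) (d ×ℚ q) (dot u ρ) (dot v ρ))

-- Moving the negative part to the left keeps all coefficients natural. In the case of `_⊝_` the
-- positive part of `t` is the value of `t` plus its negative part, and the value cancels.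
⟦⟧-coefficients : ∀ {k} (t : Term k) ρ → ⟦ t ⟧ ρ ℚ.+ dot (negative t) ρ ≡ dot (positive t) ρ
⟦⟧-coefficients (var i) ρ = trans (cong₂ ℚ._+_ (sym (dot-unit i ρ)) (dot-zero ρ)) (ℚ.+-identityʳ _)
⟦⟧-coefficients 𝟘       ρ = ℚ.+-identityˡ _
⟦⟧-coefficients (s ⊕ t) ρ = begin
  (⟦ s ⟧ ρ ℚ.+ ⟦ t ⟧ ρ) ℚ.+ dot (Vec.zipWith ℕ._+_ (negative s) (negative t)) ρ
    ≡⟨ cong (⟦ s ⊕ t ⟧ ρ ℚ.+_) (dot-+ (negative s) (negative t) ρ) ⟩
  (⟦ s ⟧ ρ ℚ.+ ⟦ t ⟧ ρ) ℚ.+ (dot (negative s) ρ ℚ.+ dot (negative t) ρ)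
    ≡⟨ ℚ-medial (⟦ s ⟧ ρ) (⟦ t ⟧ ρ) (dot (negative s) ρ) (dot (negative t) ρ) ⟩
  (⟦ s ⟧ ρ ℚ.+ dot (negative s) ρ) ℚ.+ (⟦ t ⟧ ρ ℚ.+ dot (negative t) ρ)
    ≡⟨ cong₂ ℚ._+_ (⟦⟧-coefficients s ρ) (⟦⟧-coefficients t ρ) ⟩
  dot (positive s) ρ ℚ.+ dot (positive t) ρ
    ≡⟨ dot-+ (positive s) (positive t) ρ ⟨
  dot (positive (s ⊕ t)) ρ ∎
  where open ≡-Reasoning
⟦⟧-coefficients (s ⊝ t) ρ = begin
  (⟦ s ⟧ ρ ℚ.- ⟦ t ⟧ ρ) ℚ.+ dot (Vec.zipWith ℕ._+_ (negative s) (positive t)) ρ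
    ≡⟨ cong (⟦ s ⊝ t ⟧ ρ ℚ.+_) (dot-+ (negative s) (positive t) ρ) ⟩
  (⟦ s ⟧ ρ ℚ.- ⟦ t ⟧ ρ) ℚ.+ (dot (negative s) ρ ℚ.+ dot (positive t) ρ)
    ≡⟨ ℚ-medial (⟦ s ⟧ ρ) (ℚ.- ⟦ t ⟧ ρ) (dot (negative s) ρ) (dot (positive t) ρ) ⟩
  (⟦ s ⟧ ρ ℚ.+ dot (negative s) ρ) ℚ.+ (ℚ.- ⟦ t ⟧ ρ ℚ.+ dot (positive t) ρ)
    ≡⟨ cong₂ ℚ._+_ (⟦⟧-coefficients s ρ) (cong (ℚ.- ⟦ t ⟧ ρ ℚ.+_) (sym (⟦⟧-coefficients t ρ))) ⟩
  dot (positive s) ρ ℚ.+ (ℚ.- ⟦ t ⟧ ρ ℚ.+ (⟦ t ⟧ ρ ℚ.+ dot (negative t) ρ))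
    ≡⟨ cong (dot (positive s) ρ ℚ.+_) (\\-leftDividesʳ ℚ.+-0-group (⟦ t ⟧ ρ) (dot (negative t) ρ)) ⟩
  dot (positive s) ρ ℚ.+ dot (negative t) ρ
    ≡⟨ dot-+ (positive s) (negative t) ρ ⟨
  dot (positive (s ⊝ t)) ρ ∎
  where open ≡-Reasoning

lowers uppers : ∀ {k} → List (Inequality k) → Term k
lowers []             = 𝟘
lowers ((l ≼ r) ∷ hs) = l ⊕ lowers hs
uppers []             = 𝟘
uppers ((l ≼ r) ∷ hs) = r ⊕ uppers hs

-- The conclusion is the sum of the hypotheses.
Valid : ∀ {k} → Entailment k → Set
Valid (hs ⊢ l ≼ r) = positive t ≡ negative t
  where t = r ⊕ (lowers hs ⊝ uppers hs) ⊝ l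

-- With equal coefficients on both sides, the value of `t` plus a number equals that same number, so
-- the value vanishes.
valid-⟦⟧ : ∀ {k} hs (l r : Term k) → Valid (hs ⊢ l ≼ r) → ∀ ρ →
  ⟦ l ⟧ ρ ≡ ⟦ r ⊕ (lowers hs ⊝ uppers hs) ⟧ ρ
valid-⟦⟧ hs l r valid ρ = sym (x∙y⁻¹≈ε⇒x≈y ℚ.+-0-group _ (⟦ l ⟧ ρ)
  (identityˡ-unique ℚ.+-0-group (⟦ t ⟧ ρ) (dot (negative t) ρ)
    (trans (⟦⟧-coefficients t ρ) (cong (λ u → dot u ρ) valid))))
  where t = r ⊕ (lowers hs ⊝ uppers hs) ⊝ l

module Semantics {A : Set} (_≲_ : A → A → Set) {k} (⟦_⟧ : Term k → Vec A k → A) where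
  Holds : Inequality k → Vec A k → Set
  Holds (l ≼ r) ρ = ⟦ l ⟧ ρ ≲ ⟦ r ⟧ ρ

  AllHold : List (Inequality k) → Vec A k → Set
  AllHold []       ρ = ⊤
  AllHold (h ∷ hs) ρ = Holds h ρ × AllHold hs ρ

  Follows : Entailment k → Vec A k → Set
  Follows (hs ⊢ h) ρ = AllHold hs ρ → Holds h ρ

variables : ∀ k → Vec (Term k) k
variables k = Vec.map var (Vec.allFin k)

Valid-n-ary : ∀ k → N-ary k (Term k) (Entailment k) → Set
Valid-n-ary k f = Valid (f $ⁿ variables k)

p+[q-q]≡p : ∀ p q → p ℚ.+ (q ℚ.- q) ≡ p
p+[q-q]≡p p q = trans (cong (p ℚ.+_) (ℚ.+-inverseʳ q)) (ℚ.+-identityʳ p)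

-- The hypotheses are added with coefficient one each, so one that is used several times has to be
-- listed several times. Validity compares closed vectors of naturals and is proved by `refl`.
ℚ-linear : ∀ k (f : N-ary k (Term k) (Entailment k)) → Valid-n-ary k f →
  ∀ ρ → Semantics.Follows ℚ._≤_ ⟦_⟧ (f $ⁿ variables k) ρ
ℚ-linear k f with f $ⁿ variables k
... | hs ⊢ l ≼ r = λ valid ρ all → begin
    ⟦ l ⟧ ρ
      ≡⟨ valid-⟦⟧ hs l r valid ρ ⟩
    ⟦ r ⟧ ρ ℚ.+ (⟦ lowers hs ⟧ ρ ℚ.- ⟦ uppers hs ⟧ ρ)
      ≤⟨ ℚ.+-monoʳ-≤ (⟦ r ⟧ ρ) (ℚ.+-monoˡ-≤ (ℚ.- ⟦ uppers hs ⟧ ρ) (sum-≤ hs ρ all)) ⟩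
    ⟦ r ⟧ ρ ℚ.+ (⟦ uppers hs ⟧ ρ ℚ.- ⟦ uppers hs ⟧ ρ)
      ≡⟨ p+[q-q]≡p (⟦ r ⟧ ρ) (⟦ uppers hs ⟧ ρ) ⟩
    ⟦ r ⟧ ρ ∎
  where
  open ℚ.≤-Reasoning
  sum-≤ : ∀ hs ρ → Semantics.AllHold ℚ._≤_ ⟦_⟧ hs ρ → ⟦ lowers {k} hs ⟧ ρ ℚ.≤ ⟦ uppers hs ⟧ ρ
  sum-≤ []             ρ tt        = ℚ.≤-refl
  sum-≤ ((l ≼ r) ∷ hs) ρ (h , all) = ℚ.+-mono-≤ h (sum-≤ hs ρ all)

-- Real numbers

half>0 : ∀ {δ} → 0ℚ ℚ.< δ → 0ℚ ℚ.< ½ ℚ.* δ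
half>0 {δ} 0<δ = subst (ℚ._< ½ ℚ.* δ) (ℚ.*-zeroʳ ½) (ℚ.*-monoʳ-<-pos ½ 0<δ)

p≤∣p∣ : ∀ p → p ℚ.≤ ℚ.∣ p ∣
p≤∣p∣ p with ℚ.≤-total 0ℚ p
... | inj₁ 0≤p = ℚ.≤-reflexive (sym (ℚ.0≤p⇒∣p∣≡p 0≤p))
... | inj₂ p≤0 = ℚ.≤-trans p≤0 (ℚ.0≤∣p∣ p)

near : ∀ x {δ} → 0ℚ ℚ.< δ → ∃[ N ] ∀ m n → N ℕ.≤ m → N ℕ.≤ n → seq x m ℚ.≤ seq x n ℚ.+ δ
near x {δ} 0<δ = let N , close = cauchy x δ 0<δ in N , λ m n N≤m N≤n →
  ℚ-linear 3 (λ a b d → (a ⊝ b ≼ d ∷ []) ⊢ a ≼ b ⊕ d) refl (seq x m ∷ seq x n ∷ δ ∷ [])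
    (ℚ.≤-trans (p≤∣p∣ _) (close m n N≤m N≤n) , tt)

½+½ : ∀ q → ½ ℚ.* q ℚ.+ ½ ℚ.* q ℚ.≤ q
½+½ q = ℚ.≤-reflexive (trans (sym (ℚ.*-distribʳ-+ q ½ ½)) (ℚ.*-identityˡ q))

-- The decision is made on rationals at one late index `k`. Moving to another index costs one `η`
-- per sequence: a difference of at most 3η at `k` stays within 5η, and a larger one leaves a gap of
-- `η`.
compare : ∀ x y {δ} → 0ℚ ℚ.< δ →
  (∃[ N ] ∀ n → N ℕ.≤ n → seq x n ℚ.≤ seq y n ℚ.+ δ) ⊎ y < x
compare x y {δ} 0<δ = go η η>0 (ℚ-linear 4 (λ η ζ ξ δ →
    (ξ ⊕ ξ ≼ δ) ∷ (ζ ⊕ ζ ≼ ξ) ∷ (ζ ⊕ ζ ≼ ξ) ∷ (η ⊕ η ≼ ζ) ∷ (η ⊕ η ≼ ζ) ∷ (η ⊕ η ≼ ζ) ∷ (η ⊕ η ≼ ζ) ∷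
    (𝟘 ≼ η) ∷ (𝟘 ≼ η) ∷ (𝟘 ≼ η) ∷ [] ⊢ η ⊕ η ⊕ η ⊕ η ⊕ η ≼ δ)
  refl (η ∷ ½ ℚ.* (½ ℚ.* δ) ∷ ½ ℚ.* δ ∷ δ ∷ [])
  (½+½ δ , ½+½ (½ ℚ.* δ) , ½+½ (½ ℚ.* δ) , ½+½ ζ , ½+½ ζ , ½+½ ζ , ½+½ ζ , ℚ.<⇒≤ η>0 , ℚ.<⇒≤ η>0 , ℚ.<⇒≤ η>0 , tt))
  where
  -- By repeated halving `η` is δ/8, which is small enough for 5η ≤ δ.
  ζ   = ½ ℚ.* (½ ℚ.* δ)
  η   = ½ ℚ.* ζ
  η>0 = half>0 (half>0 (half>0 0<δ))
  go : ∀ η → 0ℚ ℚ.< η → η ℚ.+ η ℚ.+ η ℚ.+ η ℚ.+ η ℚ.≤ δ →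
    (∃[ N ] ∀ n → N ℕ.≤ n → seq x n ℚ.≤ seq y n ℚ.+ δ) ⊎ y < x
  go η η>0 5η≤δ = decide (seq x k ℚ.≤? seq y k ℚ.+ η ℚ.+ η ℚ.+ η)
    where
    M = proj₁ (near x η>0)
    N = proj₁ (near y η>0)
    k = M ℕ.⊔ N
    M≤k : M ℕ.≤ k
    M≤k = ℕ.m≤m⊔n M N
    N≤k : N ℕ.≤ k
    N≤k = ℕ.m≤n⊔m M N
    closeˣ : ∀ m n → M ℕ.≤ m → M ℕ.≤ n → seq x m ℚ.≤ seq x n ℚ.+ η
    closeˣ = proj₂ (near x η>0)
    closeʸ : ∀ m n → N ℕ.≤ m → N ℕ.≤ n → seq y m ℚ.≤ seq y n ℚ.+ η
    closeʸ = proj₂ (near y η>0)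
    decide : Dec (seq x k ℚ.≤ seq y k ℚ.+ η ℚ.+ η ℚ.+ η) →
      (∃[ N ] ∀ n → N ℕ.≤ n → seq x n ℚ.≤ seq y n ℚ.+ δ) ⊎ y < x
    decide (yes xₖ≤yₖ) = inj₁ (k , λ n k≤n →
      ℚ-linear 6 (λ xk yk xn yn η δ →
          (xn ≼ xk ⊕ η) ∷ (xk ≼ yk ⊕ η ⊕ η ⊕ η) ∷ (yk ≼ yn ⊕ η) ∷ (η ⊕ η ⊕ η ⊕ η ⊕ η ≼ δ) ∷ []
            ⊢ xn ≼ yn ⊕ δ)
        refl (seq x k ∷ seq y k ∷ seq x n ∷ seq y n ∷ η ∷ δ ∷ [])
        ( closeˣ n k (ℕ.≤-trans M≤k k≤n) M≤k , xₖ≤yₖ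
        , closeʸ k n N≤k (ℕ.≤-trans N≤k k≤n) , 5η≤δ , tt))
    decide (no xₖ≰yₖ) = inj₂ (η , η>0 , k , λ n k≤n →
      ℚ-linear 5 (λ xk yk xn yn η →
          (xk ≼ xn ⊕ η) ∷ (yk ⊕ η ⊕ η ⊕ η ≼ xk) ∷ (yn ≼ yk ⊕ η) ∷ [] ⊢ yn ⊕ η ≼ xn)
        refl (seq x k ∷ seq y k ∷ seq x n ∷ seq y n ∷ η ∷ [])
        ( closeˣ k n M≤k (ℕ.≤-trans M≤k k≤n) , ℚ.<⇒≤ (ℚ.≰⇒> xₖ≰yₖ)
        , closeʸ n k (ℕ.≤-trans N≤k k≤n) N≤k , tt))

-- Unlike _≤_ and _≃_, these are injective type constructors, from which Agda
-- can infer the two real numbers.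
infix 4 _⊑_ _≈_

record _⊑_ (x y : ℝ) : Set where
  constructor ⟨_⟩
  field ⊑⇒≤ : x ≤ y

open _⊑_

record _≈_ (x y : ℝ) : Set where
  constructor _,_
  field
    ≈⇒⊑ : x ⊑ y
    ≈⇒⊒ : y ⊑ x

open _≈_

≃⇒≈ : ∀ {x y} → x ≃ y → x ≈ y
≃⇒≈ (p , q) = ⟨ p ⟩ , ⟨ q ⟩

≈⇒≃ : ∀ {x y} → x ≈ y → x ≃ y
≈⇒≃ (⟨ p ⟩ , ⟨ q ⟩) = p , q

<⇒≱ : ∀ {x y} → x < y → ¬ y ⊑ x
<⇒≱ {x} {y} (δ , 0<δ , M , gap) ⟨ y≤x ⟩ =
  ℚ.<-irrefl refl (ℚ.<-≤-trans (half>0 0<δ)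
    (ℚ-linear 4 (λ a b d h → (a ⊕ d ≼ b) ∷ (b ≼ a ⊕ h) ∷ (h ⊕ h ≼ d) ∷ [] ⊢ h ≼ 𝟘)
      refl (seq x k ∷ seq y k ∷ δ ∷ ½ ℚ.* δ ∷ [])
      (gap k (ℕ.m≤m⊔n M N) , proj₂ (y≤x (½ ℚ.* δ) (half>0 0<δ)) k (ℕ.m≤n⊔m M N) , ½+½ δ , tt)))
  where
  N = proj₁ (y≤x (½ ℚ.* δ) (half>0 0<δ))
  k = M ℕ.⊔ N

≮⇒≥ : ∀ {x y} → ¬ y < x → x ⊑ y
≮⇒≥ {x} {y} y≮x = ⟨ (λ δ 0<δ → [ id , (λ y<x → contradiction y<x y≮x) ]′ (compare x y 0<δ)) ⟩

-- By `<⇒≱` and `≮⇒≥` the order is equivalent to a negated strict inequality, and negations are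
-- stable.
⊑-stable : ∀ {x y} → ¬ ¬ x ⊑ y → x ⊑ y
⊑-stable {x} {y} ¬¬x≤y = ≮⇒≥ {x} {y} λ y<x → ¬¬x≤y (<⇒≱ {y} {x} y<x)

<⇒⊑ : ∀ {x y} → x < y → x ⊑ y
<⇒⊑ {x} {y} (δ , 0<δ , N , gap) = ⟨ (λ η 0<η → N , λ n N≤n →
  ℚ-linear 4 (λ a b d e → (a ⊕ d ≼ b) ∷ (𝟘 ≼ d) ∷ (𝟘 ≼ e) ∷ [] ⊢ a ≼ b ⊕ e)
    refl (seq x n ∷ seq y n ∷ δ ∷ η ∷ []) (gap n N≤n , ℚ.<⇒≤ 0<δ , ℚ.<⇒≤ 0<η , tt)) ⟩

⊑-total : ∀ x y → ¬ ¬ (x ⊑ y ⊎ y ⊑ x)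
⊑-total x y ¬total = ¬total (inj₁ (≮⇒≥ {x} {y} λ y<x → ¬total (inj₂ (<⇒⊑ {y} {x} y<x))))

pointwise-⊑ : ∀ {x y} → (∀ n → seq x n ℚ.≤ seq y n) → x ⊑ y
pointwise-⊑ {x} {y} x≤y = ⟨ (λ δ 0<δ → 0 , λ n _ →
  ℚ-linear 3 (λ a b d → (a ≼ b) ∷ (𝟘 ≼ d) ∷ [] ⊢ a ≼ b ⊕ d)
    refl (seq x n ∷ seq y n ∷ δ ∷ []) (x≤y n , ℚ.<⇒≤ 0<δ , tt)) ⟩

pointwise : ∀ {x y} → (∀ n → seq x n ≡ seq y n) → x ≈ y
pointwise x≡y = pointwise-⊑ (ℚ.≤-reflexive ∘ x≡y) , pointwise-⊑ (ℚ.≤-reflexive ∘ sym ∘ x≡y)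

⊑-refl : ∀ {x} → x ⊑ x
⊑-refl = pointwise-⊑ λ _ → ℚ.≤-refl

⊑-trans : ∀ {x y z} → x ⊑ y → y ⊑ z → x ⊑ z
⊑-trans {x} {y} {z} ⟨ x≤y ⟩ ⟨ y≤z ⟩ = ⟨ (λ δ 0<δ →
  let M , p = x≤y (½ ℚ.* δ) (half>0 0<δ)
      N , q = y≤z (½ ℚ.* δ) (half>0 0<δ)
  in M ℕ.⊔ N , λ n M⊔N≤n →
  ℚ-linear 5 (λ a b c d h → (a ≼ b ⊕ h) ∷ (b ≼ c ⊕ h) ∷ (h ⊕ h ≼ d) ∷ [] ⊢ a ≼ c ⊕ d)
    refl (seq x n ∷ seq y n ∷ seq z n ∷ δ ∷ ½ ℚ.* δ ∷ [])
    (p n (ℕ.m⊔n≤o⇒m≤o M N M⊔N≤n) , q n (ℕ.m⊔n≤o⇒n≤o M N M⊔N≤n) , ½+½ δ , tt)) ⟩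

-- Opaque copies of the operations: unfolding them makes conversion checking
-- compare deeply nested sums of rationals.
infixl 6 _+ᴿ_ _-ᴿ_

opaque
  _+ᴿ_ _-ᴿ_ : ℝ → ℝ → ℝ
  _+ᴿ_ = _+_
  _-ᴿ_ = _-_

  distance : ℝ → ℝ → ℝ
  distance x y = ∣ x - y ∣

  half : ℝ → ℝ
  half x = mkℝ (λ n → ½ ℚ.* seq x n) λ δ 0<δ →
    let N , close = cauchy x δ 0<δ in
    N , λ m n N≤m N≤n → begin
      ℚ.∣ ½ ℚ.* seq x m ℚ.- ½ ℚ.* seq x n ∣
        ≡⟨ cong (λ q → ℚ.∣ ½ ℚ.* seq x m ℚ.+ q ∣) (ℚ.neg-distribʳ-* ½ (seq x n)) ⟩
      ℚ.∣ ½ ℚ.* seq x m ℚ.+ ½ ℚ.* (ℚ.- seq x n) ∣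
        ≡⟨ cong ℚ.∣_∣ (ℚ.*-distribˡ-+ ½ (seq x m) (ℚ.- seq x n)) ⟨
      ℚ.∣ ½ ℚ.* (seq x m ℚ.- seq x n) ∣
        ≡⟨ ℚ.∣p*q∣≡∣p∣*∣q∣ ½ (seq x m ℚ.- seq x n) ⟩
      ½ ℚ.* ℚ.∣ seq x m ℚ.- seq x n ∣
        ≤⟨ ℚ.*-monoˡ-≤-nonNeg ½ (close m n N≤m N≤n) ⟩
      ½ ℚ.* δ
        ≤⟨ ℚ-linear 2 (λ h d → (h ⊕ h ≼ d) ∷ (𝟘 ≼ h) ∷ [] ⊢ h ≼ d) refl (½ ℚ.* δ ∷ δ ∷ [])
             (½+½ δ , ℚ.<⇒≤ (half>0 0<δ) , tt) ⟩
      δ ∎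
    where open ℚ.≤-Reasoning

  +ᴿ-def : ∀ x y → x + y ≡ x +ᴿ y
  +ᴿ-def x y = refl

  neg-def : ∀ x → - x ≈ 0ℝ -ᴿ x
  neg-def x = pointwise λ n → sym (ℚ.+-identityˡ (ℚ.- seq x n))

  distance-def : ∀ x y → ∣ x - y ∣ ≡ distance x y
  distance-def x y = refl

  seq-+ : ∀ x y n → seq (x +ᴿ y) n ≡ seq x n ℚ.+ seq y n
  seq-+ x y n = refl

  seq-- : ∀ x y n → seq (x -ᴿ y) n ≡ seq x n ℚ.- seq y n
  seq-- x y n = refl

  +-mono-⊑ : ∀ {x y z w} → x ⊑ y → z ⊑ w → x +ᴿ z ⊑ y +ᴿ w
  +-mono-⊑ {x} {y} {z} {w} ⟨ x≤y ⟩ ⟨ z≤w ⟩ = ⟨ (λ δ 0<δ →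
    let M , p = x≤y (½ ℚ.* δ) (half>0 0<δ)
        N , q = z≤w (½ ℚ.* δ) (half>0 0<δ)
    in M ℕ.⊔ N , λ n M⊔N≤n →
    ℚ-linear 6 (λ a b c e d h → (a ≼ b ⊕ h) ∷ (c ≼ e ⊕ h) ∷ (h ⊕ h ≼ d) ∷ [] ⊢ a ⊕ c ≼ b ⊕ e ⊕ d)
      refl (seq x n ∷ seq y n ∷ seq z n ∷ seq w n ∷ δ ∷ ½ ℚ.* δ ∷ [])
      (p n (ℕ.m⊔n≤o⇒m≤o M N M⊔N≤n) , q n (ℕ.m⊔n≤o⇒n≤o M N M⊔N≤n) , ½+½ δ , tt)) ⟩

  half+half : ∀ x → half x +ᴿ half x ≈ x
  half+half x = pointwise λ n →
    trans (sym (ℚ.*-distribʳ-+ (seq x n) ½ ½)) (ℚ.*-identityˡ (seq x n))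

  halve-⊑ : ∀ {x y} → x +ᴿ x ⊑ y +ᴿ y → x ⊑ y
  halve-⊑ {x} {y} 2x≤2y = ≮⇒≥ {x} {y} λ { (δ , 0<δ , N , gap) → <⇒≱ {y + y} {x + x}
    (δ , 0<δ , N , λ n N≤n → ℚ-linear 3 (λ a b d → (a ⊕ d ≼ b) ∷ (a ⊕ d ≼ b) ∷ (𝟘 ≼ d) ∷ [] ⊢ a ⊕ a ⊕ d ≼ b ⊕ b)
      refl (seq y n ∷ seq x n ∷ δ ∷ []) (gap n N≤n , gap n N≤n , ℚ.<⇒≤ 0<δ , tt)) 2x≤2y }

  x-y⊑distance : ∀ x y → x -ᴿ y ⊑ distance x y
  x-y⊑distance x y = pointwise-⊑ λ n → p≤∣p∣ (seq x n ℚ.- seq y n)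

  y-x⊑distance : ∀ x y → y -ᴿ x ⊑ distance x y
  y-x⊑distance x y = pointwise-⊑ λ n → subst (ℚ._≤ ℚ.∣ seq x n ℚ.- seq y n ∣)
    (⁻¹-anti-homo-// ℚ.+-0-group (seq x n) (seq y n))
    (ℚ.≤-trans (p≤∣p∣ (ℚ.- (seq x n ℚ.- seq y n))) (ℚ.≤-reflexive (ℚ.∣-p∣≡∣p∣ (seq x n ℚ.- seq y n))))

  distance-⊑ : ∀ {x y d} → x -ᴿ y ⊑ d → y -ᴿ x ⊑ d → distance x y ⊑ d
  distance-⊑ {x} {y} {d} ⟨ p ⟩ ⟨ q ⟩ = ⟨ (λ δ 0<δ →
    let M , p′ = p δ 0<δ
        N , q′ = q δ 0<δ
    in M ℕ.⊔ N , λ n M⊔N≤n →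
    bound (seq x n) (seq y n) (p′ n (ℕ.m⊔n≤o⇒m≤o M N M⊔N≤n)) (q′ n (ℕ.m⊔n≤o⇒n≤o M N M⊔N≤n))) ⟩
    where
    bound : ∀ a b {c} → a ℚ.- b ℚ.≤ c → b ℚ.- a ℚ.≤ c → ℚ.∣ a ℚ.- b ∣ ℚ.≤ c
    bound a b {c} a-b≤c b-a≤c = [ (λ eq → subst (ℚ._≤ c) (sym eq) a-b≤c)
      , (λ eq → subst (ℚ._≤ c) (sym (trans eq (⁻¹-anti-homo-// ℚ.+-0-group a b))) b-a≤c)
      ]′ (ℚ.∣p∣≡p∨∣p∣≡-p (a ℚ.- b))

  0⊑distance : ∀ x y → 0ℝ ⊑ distance x y
  0⊑distance x y = pointwise-⊑ λ n → ℚ.0≤∣p∣ (seq x n ℚ.- seq y n)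

+-mono-≈ : ∀ {x y z w} → x ≈ y → z ≈ w → x +ᴿ z ≈ y +ᴿ w
+-mono-≈ (p , q) (r , s) = +-mono-⊑ p r , +-mono-⊑ q s

⟦_⟧ᴿ : ∀ {k} → Term k → Vec ℝ k → ℝ
⟦ var i ⟧ᴿ ρ = Vec.lookup ρ i
⟦ 𝟘 ⟧ᴿ     ρ = 0ℝ
⟦ s ⊕ t ⟧ᴿ ρ = ⟦ s ⟧ᴿ ρ +ᴿ ⟦ t ⟧ᴿ ρ
⟦ s ⊝ t ⟧ᴿ ρ = ⟦ s ⟧ᴿ ρ -ᴿ ⟦ t ⟧ᴿ ρ

seq-⟦⟧ᴿ : ∀ {k} (t : Term k) ρ n → seq (⟦ t ⟧ᴿ ρ) n ≡ ⟦ t ⟧ (Vec.map (λ x → seq x n) ρ)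
seq-⟦⟧ᴿ (var i) ρ n = sym (lookup-map i (λ x → seq x n) ρ)
seq-⟦⟧ᴿ 𝟘       ρ n = refl
seq-⟦⟧ᴿ (s ⊕ t) ρ n = trans (seq-+ (⟦ s ⟧ᴿ ρ) (⟦ t ⟧ᴿ ρ) n) (cong₂ ℚ._+_ (seq-⟦⟧ᴿ s ρ n) (seq-⟦⟧ᴿ t ρ n))
seq-⟦⟧ᴿ (s ⊝ t) ρ n = trans (seq-- (⟦ s ⟧ᴿ ρ) (⟦ t ⟧ᴿ ρ) n) (cong₂ ℚ._-_ (seq-⟦⟧ᴿ s ρ n) (seq-⟦⟧ᴿ t ρ n))

⟦⟧-⊑ : ∀ {k} (s t : Term k) → (∀ ρ → ⟦ s ⟧ ρ ≡ ⟦ t ⟧ ρ) → ∀ ρ → ⟦ s ⟧ᴿ ρ ⊑ ⟦ t ⟧ᴿ ρ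
⟦⟧-⊑ s t s≡t ρ = pointwise-⊑ λ n → ℚ.≤-reflexive
  (trans (seq-⟦⟧ᴿ s ρ n) (trans (s≡t (Vec.map (λ x → seq x n) ρ)) (sym (seq-⟦⟧ᴿ t ρ n))))

telescope : ∀ r {l u} → l ⊑ u → r +ᴿ (l -ᴿ u) ⊑ r
telescope r {l} {u} ⟨ l≤u ⟩ = ⟨ (λ δ 0<δ → let N , p = l≤u δ 0<δ in N , λ n N≤n →
  subst (ℚ._≤ seq r n ℚ.+ δ) (sym (trans (seq-+ r (l -ᴿ u) n) (cong (seq r n ℚ.+_) (seq-- l u n))))
    (ℚ-linear 4 (λ r l u d → (l ≼ u ⊕ d) ∷ [] ⊢ r ⊕ (l ⊝ u) ≼ r ⊕ d)
      refl (seq r n ∷ seq l n ∷ seq u n ∷ δ ∷ []) (p n N≤n , tt))) ⟩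

-- The identity between the terms is exact and holds at every index of the sequences. Only the
-- summed hypotheses involve a tolerance, and `telescope` absorbs it.
linear : ∀ k (f : N-ary k (Term k) (Entailment k)) → Valid-n-ary k f →
  ∀ ρ → Semantics.Follows _⊑_ ⟦_⟧ᴿ (f $ⁿ variables k) ρ
linear k f with f $ⁿ variables k
... | hs ⊢ l ≼ r = λ valid ρ all → ⊑-trans
  (⟦⟧-⊑ l (r ⊕ (lowers hs ⊝ uppers hs)) (valid-⟦⟧ hs l r valid) ρ)
  (telescope (⟦ r ⟧ᴿ ρ) (sum-⊑ hs ρ all))
  where
  sum-⊑ : ∀ hs ρ → Semantics.AllHold _⊑_ ⟦_⟧ᴿ hs ρ → ⟦ lowers {k} hs ⟧ᴿ ρ ⊑ ⟦ uppers hs ⟧ᴿ ρ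
  sum-⊑ []             ρ tt        = ⊑-refl
  sum-⊑ ((l ≼ r) ∷ hs) ρ (h , all) = +-mono-⊑ h (sum-⊑ hs ρ all)

equation : ∀ k (f : N-ary k (Term k) (Term k × Term k)) → let s , t = f $ⁿ variables k in
  Valid ([] ⊢ s ≼ t) → Valid ([] ⊢ t ≼ s) → ∀ ρ → ⟦ s ⟧ᴿ ρ ≈ ⟦ t ⟧ᴿ ρ
equation k f p q ρ = let s , t = f $ⁿ variables k in
  ⟦⟧-⊑ s t (λ ρ → trans (valid-⟦⟧ [] s t p ρ) (p+[q-q]≡p (⟦ t ⟧ ρ) 0ℚ)) ρ ,
  ⟦⟧-⊑ t s (λ ρ → trans (valid-⟦⟧ [] t s q ρ) (p+[q-q]≡p (⟦ s ⟧ ρ) 0ℚ)) ρ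

+ᴿ-0-commutativeMonoid : CommutativeMonoid _ _
+ᴿ-0-commutativeMonoid = record
  { Carrier = ℝ ; _≈_ = _≈_ ; _∙_ = _+ᴿ_ ; ε = 0ℝ
  ; isCommutativeMonoid = record
    { isMonoid = record
      { isSemigroup = record
        { isMagma = record
          { isEquivalence = record
            { refl  = ⊑-refl , ⊑-refl
            ; sym   = λ (p , q) → q , p
            ; trans = λ (p , q) (r , s) → ⊑-trans p r , ⊑-trans s q
            }
          ; ∙-cong = +-mono-≈
          }
        ; assoc = λ x y z → equation 3 (λ x y z → x ⊕ y ⊕ z , x ⊕ (y ⊕ z)) refl refl (x ∷ y ∷ z ∷ [])
        }
      ; identity = (λ x → equation 1 (λ x → 𝟘 ⊕ x , x) refl refl (x ∷ []))
                 , (λ x → equation 1 (λ x → x ⊕ 𝟘 , x) refl refl (x ∷ []))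
      }
    ; comm = λ x y → equation 2 (λ x y → x ⊕ y , y ⊕ x) refl refl (x ∷ y ∷ [])
    }
  }

open CommutativeMonoid +ᴿ-0-commutativeMonoid using ()
  renaming ( rawMonoid to +ᴿ-0-rawMonoid; reflexive to ≈-reflexive
           ; refl to ≈-refl; sym to ≈-sym; trans to ≈-trans)
open import Algebra.Properties.CommutativeMonoid.Sum +ᴿ-0-commutativeMonoid
  using (∑-comm; ∑-distrib-+; sum-cong-≋; sum-replicate; sum-replicate-zero)
open import Algebra.Properties.CommutativeMonoid.Mult +ᴿ-0-commutativeMonoid
  using () renaming (×-homo-+ to ×ᴿ-homo-+; ×-distrib-+ to ×ᴿ-distrib-+)

_×ᴿ_ : ℕ → ℝ → ℝ
_×ᴿ_ = multiple +ᴿ-0-rawMonoid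

Σᴿ : ∀ {n} → (Fin n → ℝ) → ℝ
Σᴿ = sum +ᴿ-0-rawMonoid

×ᴿ-def : ∀ n x → multiple +-0-rawMonoid n x ≡ n ×ᴿ x
×ᴿ-def zero    x = refl
×ᴿ-def (suc n) x = trans (+ᴿ-def x (multiple +-0-rawMonoid n x)) (cong (x +ᴿ_) (×ᴿ-def n x))

Σᴿ-def : ∀ {n} (f : Fin n → ℝ) → sum +-0-rawMonoid f ≡ Σᴿ f
Σᴿ-def = foldr-cong +ᴿ-def
  where
  foldr-cong : ∀ {A : Set} {_∙_ _∗_ : A → A → A} {e} → (∀ x y → x ∙ y ≡ x ∗ y) →
    ∀ {n} (f : Fin n → A) → Vector.foldr _∙_ e f ≡ Vector.foldr _∗_ e f
  foldr-cong           eq {zero}  f = refl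
  foldr-cong {_∗_ = _∗_} eq {suc n} f = trans (eq _ _) (cong (f zero ∗_) (foldr-cong eq (f ∘ suc)))

-- Rational constants and the archimedean property

const : ℚ → ℝ
const q = mkℝ (λ _ → q) λ δ 0<δ → 0 , λ _ _ _ _ → ℚ.≤-trans (ℚ.≤-reflexive (cong ℚ.∣_∣ (ℚ.+-inverseʳ q))) (ℚ.<⇒≤ 0<δ)

-- Without normalisation the multiple keeps the denominator of `p`, so it can be compared with
-- another fraction by cross-multiplication.
toℚᵘ-×ℚ : ∀ n p → ℚ.toℚᵘ (n ×ℚ p) ℚᵘ.≃ ℚᵘ.mkℚᵘ (+ n ℤ.* ℚ.↥ p) (ℚ.denominator-1 p)
toℚᵘ-×ℚ zero    p = ℚᵘ.*≡* refl
toℚᵘ-×ℚ (suc n) p@record{} = ℚᵘ.≃-trans (ℚ.toℚᵘ-homo-+ p (n ×ℚ p))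
  (ℚᵘ.≃-trans (ℚᵘ.+-congʳ (ℚ.toℚᵘ p) (toℚᵘ-×ℚ n p)) (ℚᵘ.*≡* (eq (+ n) (ℚ.↥ p) (ℚ.↧ p))))
  where
  eq : ∀ n a b → (a ℤ.* b ℤ.+ (n ℤ.* a) ℤ.* b) ℤ.* b ≡ ((ℤ.1ℤ ℤ.+ n) ℤ.* a) ℤ.* (b ℤ.* b)
  eq = Z.solve 3 (λ n a b → (a Z.:* b Z.:+ (n Z.:* a) Z.:* b) Z.:* b
                    Z.:= ((Z.con ℤ.1ℤ Z.:+ n) Z.:* a) Z.:* (b Z.:* b)) refl

ℚ-archimedean : ∀ {η} → 0ℚ ℚ.< η → ∀ q → ∃[ n ] q ℚ.≤ n ×ℚ η
ℚ-archimedean {η@(ℚ.mkℚ (+ suc a) d _)} 0<η q = n , ℚ.toℚᵘ-cancel-≤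
  (ℚᵘ.≤-trans (bound q) (ℚᵘ.≤-reflexive (ℚᵘ.≃-sym (toℚᵘ-×ℚ n η))))
  where
  -- A positive `η` is at least the inverse of its denominator `suc d`, so this multiple of `η` is
  -- at least the absolute numerator of `q`, which is at least `q`.
  n = ℤ.∣ ℚ.↥ q ∣ ℕ.* suc d
  bound : ∀ q → ℚ.toℚᵘ q ℚᵘ.≤ ℚᵘ.mkℚᵘ (+ (ℤ.∣ ℚ.↥ q ∣ ℕ.* suc d) ℤ.* + suc a) d
  bound (ℚ.mkℚ (+ b) c _) = ℚᵘ.*≤* (subst₂ ℤ._≤_ (ℤ.pos-* b (suc d))
     (trans (ℤ.pos-* (b ℕ.* suc d ℕ.* suc a) (suc c)) (cong (ℤ._* + suc c) (ℤ.pos-* (b ℕ.* suc d) (suc a))))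
     (ℤ.+≤+ (ℕ.≤-trans (ℕ.m≤m*n (b ℕ.* suc d) (suc a)) (ℕ.m≤m*n (b ℕ.* suc d ℕ.* suc a) (suc c)))))
  bound (ℚ.mkℚ -[1+ b ] c _) = ℚᵘ.*≤* (subst (-[1+ b ] ℤ.* + suc d ℤ.≤_)
     (trans (ℤ.pos-* (suc b ℕ.* suc d ℕ.* suc a) (suc c)) (cong (ℤ._* + suc c) (ℤ.pos-* (suc b ℕ.* suc d) (suc a))))
     ℤ.-≤+)
ℚ-archimedean {ℚ.mkℚ (+ zero) _ _} (ℚ.*<* (ℤ.+<+ ()))
ℚ-archimedean {ℚ.mkℚ -[1+ _ ] _ _} (ℚ.*<* ())

archimedean : ∀ {η} → 0ℚ ℚ.< η → ∀ x → ∃[ n ] x < n ×ᴿ const η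
-- One of the two extra copies of `η` pays for the oscillation of `x` after `N`, the other is the
-- strict gap.
archimedean {η} 0<η x = suc (suc n) , η , 0<η , N , λ m N≤m →
  subst (seq x m ℚ.+ η ℚ.≤_) (sym (seq-×ᴿ (suc (suc n)) m))
    (ℚ-linear 4 (λ a b q e → (a ≼ b ⊕ e) ∷ (b ≼ q) ∷ [] ⊢ a ⊕ e ≼ e ⊕ (e ⊕ q))
      refl (seq x m ∷ seq x N ∷ n ×ℚ η ∷ η ∷ [])
      (proj₂ (near x 0<η) m N N≤m ℕ.≤-refl , proj₂ (ℚ-archimedean 0<η (seq x N)) , tt))
  where
  N = proj₁ (near x 0<η)
  n = proj₁ (ℚ-archimedean 0<η (seq x N))
  seq-×ᴿ : ∀ n m → seq (n ×ᴿ const η) m ≡ n ×ℚ η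
  seq-×ᴿ zero    m = refl
  seq-×ᴿ (suc n) m = trans (seq-+ (const η) (n ×ᴿ const η) m) (cong (η ℚ.+_) (seq-×ᴿ n m))

-- Finite sums

Σ-mono : ∀ {n} {f g : Fin n → ℝ} → (∀ i → f i ⊑ g i) → Σᴿ f ⊑ Σᴿ g
Σ-mono {zero}  f⊑g = ⊑-refl
Σ-mono {suc n} f⊑g = +-mono-⊑ (f⊑g zero) (Σ-mono (f⊑g ∘ suc))

infix 3.5 _when_

-- The Iverson bracket, which turns counting into sums whose order can be exchanged.
_when_ : {P : Set} → ℝ → Dec P → ℝ
x when d = if does d then x else 0ℝ

Σ-when-none : ∀ {n c} {P : Fin n → Set} (P? : Decidable P) → (∀ i → ¬ P i) →
  Σᴿ (λ i → c when P? i) ≈ 0ℝ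
Σ-when-none {n} {c} P? ¬P = ≈-trans (sum-cong-≋ λ i → none (P? i) (¬P i)) (sum-replicate-zero n)
  where
  none : ∀ {P} (d : Dec P) → ¬ P → (c when d) ≈ 0ℝ
  none (yes p) ¬p = contradiction p ¬p
  none (no _)  ¬p = ≈-refl

Σ-when-unique : ∀ {n c} {P : Fin n → Set} (P? : Decidable P) → (∀ i j → P i → P j → i ≡ j) →
  0ℝ ⊑ c → Σᴿ (λ i → c when P? i) ⊑ c
Σ-when-unique {zero}      P? unique 0⊑c = 0⊑c
Σ-when-unique {suc n} {c} P? unique 0⊑c with P? zero
... | yes p = ⊑-trans
  (+-mono-⊑ ⊑-refl (≈⇒⊑ (Σ-when-none (P? ∘ suc) λ i q → Fin.0≢1+n (unique zero (suc i) p q))))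
  (linear 1 (λ c → [] ⊢ c ⊕ 𝟘 ≼ c) refl (c ∷ []) tt)
... | no _  = ⊑-trans
  (+-mono-⊑ (⊑-refl {0ℝ}) (Σ-when-unique (P? ∘ suc) (λ i j p q → Fin.suc-injective (unique (suc i) (suc j) p q)) 0⊑c))
  (linear 1 (λ c → [] ⊢ 𝟘 ⊕ c ≼ c) refl (c ∷ []) tt)

Σ-when-≡ : ∀ {n} (f : Fin n → ℝ) i → Σᴿ (λ j → f j when i Fin.≟ j) ≈ f i
Σ-when-≡ {suc n} f zero    = ≈-trans (+-mono-≈ ≈-refl (sum-replicate-zero n))
  (equation 1 (λ c → c ⊕ 𝟘 , c) refl refl (f zero ∷ []))
Σ-when-≡ {suc n} f (suc i) = ≈-trans (+-mono-≈ ≈-refl (Σ-when-≡ (f ∘ suc) i))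
  (equation 1 (λ c → 𝟘 ⊕ c , c) refl refl (f (suc i) ∷ []))

count-×ᴿ : ∀ {A : Set} {P : A → Set} (P? : Decidable P) {n} (f : Fin n → A) c →
  Vec.count P? (Vec.tabulate f) ×ᴿ c ≈ Σᴿ (λ i → c when P? (f i))
count-×ᴿ P? {zero}  f c = ≈-refl
count-×ᴿ P? {suc n} f c with P? (f zero)
... | yes _ = +-mono-≈ ≈-refl (count-×ᴿ P? (f ∘ suc) c)
... | no _  = ≈-trans (count-×ᴿ P? (f ∘ suc) c)
  (equation 1 (λ c → c , 𝟘 ⊕ c) refl refl (Σᴿ (λ i → c when P? (f (suc i))) ∷ []))

-- Double counting: `g (π i)` is the sum over `j` of `g j` restricted to `π i ≡ j`. After exchanging
-- the sums, each `j` collects `g j` at most once, and nonnegativity covers the `j` outside the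
-- image.
Σ-injection : ∀ {m n} (π : Fin m → Fin n) → (∀ i j → π i ≡ π j → i ≡ j) →
  (g : Fin n → ℝ) → (∀ i → 0ℝ ⊑ g i) → Σᴿ (g ∘ π) ⊑ Σᴿ g
Σ-injection π injective g 0⊑g = ⊑-trans
  (≈⇒⊑ (≈-trans (≈-sym (sum-cong-≋ λ i → Σ-when-≡ g (π i))) (∑-comm λ i j → g j when π i Fin.≟ j)))
  (Σ-mono λ j → Σ-when-unique (λ i → π i Fin.≟ j) (λ i i′ p q → injective i i′ (trans p (sym q))) (0⊑g j))

-- Applied to `src` and to `tgt`, this is the weighted handshake identity: a sum over vertices
-- weighted by degree becomes a sum over the ends of edges.
Σ-count : ∀ {m n} (φ : Fin m → Fin n) (f : Fin n → ℝ) →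
  Σᴿ (λ v → Vec.count (λ e → φ e Fin.≟ v) (Vec.allFin m) ×ᴿ f v) ≈ Σᴿ (f ∘ φ)
Σ-count φ f = ≈-trans (sum-cong-≋ λ v → count-×ᴿ (λ e → φ e Fin.≟ v) id (f v))
  (≈-trans (∑-comm λ v e → f v when φ e Fin.≟ v) (sum-cong-≋ λ e → Σ-when-≡ f (φ e)))

-- Minima of sets of real numbers

open RawMonad (¬¬-Monad {0ℓ}) using (_>>=_; pure; rawApplicative)

LowerBound : Pred ℝ 0ℓ → ℝ → Set
LowerBound P b = ∀ {l} → P l → b ⊑ l

HasMinimum : Pred ℝ 0ℓ → Set
HasMinimum P = ∃[ m ] P m × LowerBound P m

-- A minimum truncated at `b`: values from `b` on need no inspection. This replaces the infinite
-- family of walks by a finite search, whose level `b` can be raised as far as desired.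
MinimumBelow : ℝ → Pred ℝ 0ℓ → Set
MinimumBelow b P = LowerBound P b ⊎ HasMinimum P

module _ {b : ℝ} where

  minimum-⇔ : ∀ {P Q} → P ⊆ Q → Q ⊆ P → MinimumBelow b P → MinimumBelow b Q
  minimum-⇔ P⊆Q Q⊆P (inj₁ low)            = inj₁ (low ∘ Q⊆P)
  minimum-⇔ P⊆Q Q⊆P (inj₂ (m , Pm , low)) = inj₂ (m , P⊆Q Pm , low ∘ Q⊆P)

  -- Real numbers can be compared only up to double negation. When a minimum of one set lies above
  -- the level `b` of the other, `b` takes over as lower bound.
  minimum-∪ : ∀ {P Q} → MinimumBelow b P → MinimumBelow b Q → ¬ ¬ MinimumBelow b (P ∪ Q)
  minimum-∪ (inj₁ p) (inj₁ q) = pure (inj₁ λ {_} → [ p , q ]′)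
  minimum-∪ (inj₁ p) (inj₂ (m , Qm , q)) = ⊑-total b m >>= λ where
    (inj₁ b⊑m) → pure (inj₁ λ {_} → [ p , ⊑-trans b⊑m ∘ q ]′)
    (inj₂ m⊑b) → pure (inj₂ (m , inj₂ Qm , λ {_} → [ ⊑-trans m⊑b ∘ p , q ]′))
  minimum-∪ (inj₂ (m , Pm , p)) (inj₁ q) = ⊑-total b m >>= λ where
    (inj₁ b⊑m) → pure (inj₁ λ {_} → [ ⊑-trans b⊑m ∘ p , q ]′)
    (inj₂ m⊑b) → pure (inj₂ (m , inj₁ Pm , λ {_} → [ p , ⊑-trans m⊑b ∘ q ]′))
  minimum-∪ (inj₂ (m , Pm , p)) (inj₂ (n , Qn , q)) = ⊑-total m n >>= λ where
    (inj₁ m⊑n) → pure (inj₂ (m , inj₁ Pm , λ {_} → [ p , ⊑-trans m⊑n ∘ q ]′))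
    (inj₂ n⊑m) → pure (inj₂ (n , inj₂ Qn , λ {_} → [ ⊑-trans n⊑m ∘ p , q ]′))

  minimum-⋃ : ∀ {n} (P : Fin n → Pred ℝ 0ℓ) → (∀ i → ¬ ¬ MinimumBelow b (P i)) →
    ¬ ¬ MinimumBelow b (λ l → ∃[ i ] P i l)
  minimum-⋃ {zero}  P min = pure (inj₁ λ ())
  minimum-⋃ {suc n} P min = min zero >>= λ p → minimum-⋃ (P ∘ suc) (min ∘ suc) >>= λ q →
    ¬¬-map (minimum-⇔
        (λ { (inj₁ p) → zero , p ; (inj₂ (i , p)) → suc i , p })
        (λ { (zero , p) → inj₁ p ; (suc i , p) → inj₂ (i , p) }))
      (minimum-∪ p q)

  minimum-× : ∀ {A : Set} {P} → Dec A → MinimumBelow b P → MinimumBelow b (λ l → A × P l)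
  minimum-× (yes a) min = minimum-⇔ (a ,_) proj₂ min
  minimum-× (no ¬a) min = inj₁ λ (a , _) → contradiction a ¬a

  -- Crossing an edge of length `c` raises the truncation level by `η`. This gain is what makes the
  -- search for shortest walks progress.
  minimum-shift : ∀ {P η c} → η ⊑ c → MinimumBelow b P →
    MinimumBelow (η +ᴿ b) (λ l → ∃[ k ] P k × k +ᴿ c ⊑ l)
  minimum-shift {η = η} {c} η⊑c (inj₁ low) = inj₁ λ {l} (k , Pk , k+c⊑l) →
    linear 5 (λ b k η c l → (b ≼ k) ∷ (η ≼ c) ∷ (k ⊕ c ≼ l) ∷ [] ⊢ η ⊕ b ≼ l)
      refl (b ∷ k ∷ η ∷ c ∷ l ∷ []) (low Pk , η⊑c , k+c⊑l , tt)
  minimum-shift {c = c} η⊑c (inj₂ (m , Pm , low)) = inj₂ (m +ᴿ c , (m , Pm , ⊑-refl) ,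
    λ (k , Pk , k+c⊑l) → ⊑-trans (+-mono-⊑ (low Pk) ⊑-refl) k+c⊑l)

const-mono : ∀ {p q} → p ℚ.≤ q → const p ⊑ const q
const-mono p≤q = pointwise-⊑ λ _ → p≤q

positive⇒const : ∀ {x} → 0ℝ < x → ∃[ η ] 0ℚ ℚ.< η × const η ⊑ x
positive⇒const {x} (η , 0<η , N , gap) = η , 0<η , ⟨ (λ δ 0<δ → N , λ n N≤n →
  ℚ-linear 3 (λ e x d → (𝟘 ⊕ e ≼ x) ∷ (𝟘 ≼ d) ∷ [] ⊢ e ≼ x ⊕ d) refl (η ∷ seq x n ∷ δ ∷ [])
    (gap n N≤n , ℚ.<⇒≤ 0<δ , tt)) ⟩

common-const : ∀ {n} (f : Fin n → ℝ) → (∀ i → 0ℝ < f i) → ∃[ η ] 0ℚ ℚ.< η × ∀ i → const η ⊑ f i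
-- For an empty family any positive constant serves.
common-const {zero}  f 0<f = ℚ.1ℚ , ℚ.positive⁻¹ ℚ.1ℚ , λ ()
common-const {suc n} f 0<f =
  let δ , 0<δ , δ⊑ = positive⇒const {f zero} (0<f zero)
      η , 0<η , η⊑ = common-const (f ∘ suc) (0<f ∘ suc)
  in δ ℚ.⊓ η
   , [ (λ eq → subst (0ℚ ℚ.<_) (sym eq) 0<δ) , (λ eq → subst (0ℚ ℚ.<_) (sym eq) 0<η) ]′ (ℚ.⊓-sel δ η)
   , λ where
     zero    → ⊑-trans (const-mono (ℚ.p⊓q≤p δ η)) δ⊑
     (suc i) → ⊑-trans (const-mono (ℚ.p⊓q≤q δ η)) (η⊑ i)

≤-refl : ∀ x → x ≤ x
≤-refl x = ⊑⇒≤ (⊑-refl {x})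

≃-refl : ∀ x → x ≃ x
≃-refl x = ≤-refl x , ≤-refl x

-- Distances from a root

module _ {G : MetricGraph} where

  stepLength′ : ∀ {p q} → Step G p q → ℝ
  stepLength′ (segment e s t)  = distance s t
  stepLength′ (glue-src e t _) = 0ℝ
  stepLength′ (glue-tgt e t _) = 0ℝ

  length : ∀ {p q} → Path G p q → ℝ
  length ε           = 0ℝ
  length (fwd s ◅ π) = stepLength′ s +ᴿ length π
  length (bwd s ◅ π) = stepLength′ s +ᴿ length π

  stepLength-def : ∀ {p q} (s : Step G p q) → stepLength G s ≡ stepLength′ s
  stepLength-def (segment e s t)  = distance-def s t
  stepLength-def (glue-src e t _) = refl
  stepLength-def (glue-tgt e t _) = refl

  length-def : ∀ {p q} (π : Path G p q) → pathLength G π ≡ length π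
  length-def ε           = refl
  length-def (fwd s ◅ π) = trans (+ᴿ-def _ _) (cong₂ _+ᴿ_ (stepLength-def s) (length-def π))
  length-def (bwd s ◅ π) = trans (+ᴿ-def _ _) (cong₂ _+ᴿ_ (stepLength-def s) (length-def π))

  length-◅◅ : ∀ {p q r} (π : Path G p q) (ρ : Path G q r) → length (π ◅◅ ρ) ⊑ length π +ᴿ length ρ
  length-◅◅ ε           ρ = linear 1 (λ x → [] ⊢ x ≼ 𝟘 ⊕ x) refl (length ρ ∷ []) tt
  length-◅◅ (fwd s ◅ π) ρ = linear 4 (λ x y z w → (x ≼ y ⊕ z) ∷ [] ⊢ w ⊕ x ≼ w ⊕ y ⊕ z) refl
    (length (π ◅◅ ρ) ∷ length π ∷ length ρ ∷ stepLength′ s ∷ []) (length-◅◅ π ρ , tt)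
  length-◅◅ (bwd s ◅ π) ρ = linear 4 (λ x y z w → (x ≼ y ⊕ z) ∷ [] ⊢ w ⊕ x ≼ w ⊕ y ⊕ z) refl
    (length (π ◅◅ ρ) ∷ length π ∷ length ρ ∷ stepLength′ s ∷ []) (length-◅◅ π ρ , tt)

  stepLength-nonneg : ∀ {p q} (s : Step G p q) → 0ℝ ⊑ stepLength′ s
  stepLength-nonneg (segment e s t)  = 0⊑distance s t
  stepLength-nonneg (glue-src e t _) = ⊑-refl
  stepLength-nonneg (glue-tgt e t _) = ⊑-refl

  length-nonneg : ∀ {p q} (π : Path G p q) → 0ℝ ⊑ length π
  length-nonneg ε           = ⊑-refl
  length-nonneg (fwd s ◅ π) = linear 2 (λ x y → (𝟘 ≼ x) ∷ (𝟘 ≼ y) ∷ [] ⊢ 𝟘 ≼ x ⊕ y) refl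
    (stepLength′ s ∷ length π ∷ []) (stepLength-nonneg s , length-nonneg π , tt)
  length-nonneg (bwd s ◅ π) = linear 2 (λ x y → (𝟘 ≼ x) ∷ (𝟘 ≼ y) ∷ [] ⊢ 𝟘 ≼ x ⊕ y) refl
    (stepLength′ s ∷ length π ∷ []) (stepLength-nonneg s , length-nonneg π , tt)

module Rooted (G : MetricGraph) (e₀ : Fin (MetricGraph.∣E∣ G)) (t₀ : ℝ)
  (0⊑t₀ : 0ℝ ⊑ t₀) (t₀⊑len : t₀ ⊑ MetricGraph.len G e₀) where

  open MetricGraph G

  0⊑len : ∀ e → 0ℝ ⊑ len e
  0⊑len e = <⇒⊑ {0ℝ} {len e} (len>0 e)

  0≤len : ∀ e → 0ℝ ≤ len e
  0≤len e = ⊑⇒≤ (0⊑len e)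

  0⊑len-t₀ : 0ℝ ⊑ len e₀ -ᴿ t₀
  0⊑len-t₀ = linear 2 (λ t l → (t ≼ l) ∷ [] ⊢ 𝟘 ≼ l ⊝ t) refl (t₀ ∷ len e₀ ∷ []) (t₀⊑len , tt)

  root : Point G
  root = on e₀ t₀ (⊑⇒≤ 0⊑t₀) (⊑⇒≤ t₀⊑len)

  -- Walks along whole edges from the root to a vertex, of length at most l.
  data Walk : Fin ∣V∣ → ℝ → Set where
    startSrc : ∀ {l} → t₀ ⊑ l → Walk (src e₀) l
    startTgt : ∀ {l} → len e₀ -ᴿ t₀ ⊑ l → Walk (tgt e₀) l
    forward  : ∀ e {k l} → Walk (src e) k → k +ᴿ len e ⊑ l → Walk (tgt e) l
    backward : ∀ e {k l} → Walk (tgt e) k → k +ᴿ len e ⊑ l → Walk (src e) l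

  Walk-⊑ : ∀ {v k l} → Walk v k → k ⊑ l → Walk v l
  Walk-⊑ (startSrc p)     k⊑l = startSrc (⊑-trans p k⊑l)
  Walk-⊑ (startTgt p)     k⊑l = startTgt (⊑-trans p k⊑l)
  Walk-⊑ (forward e w p)  k⊑l = forward e w (⊑-trans p k⊑l)
  Walk-⊑ (backward e w p) k⊑l = backward e w (⊑-trans p k⊑l)

  walk-nonneg : ∀ {v l} → Walk v l → 0ℝ ⊑ l
  walk-nonneg (startSrc p) = ⊑-trans 0⊑t₀ p
  walk-nonneg (startTgt p) = ⊑-trans 0⊑len-t₀ p
  walk-nonneg (forward e {k} {l} w p) =
    linear 3 (λ k c l → (k ⊕ c ≼ l) ∷ (𝟘 ≼ k) ∷ (𝟘 ≼ c) ∷ [] ⊢ 𝟘 ≼ l) refl (k ∷ len e ∷ l ∷ [])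
      (p , walk-nonneg w , 0⊑len e , tt)
  walk-nonneg (backward e {k} {l} w p) =
    linear 3 (λ k c l → (k ⊕ c ≼ l) ∷ (𝟘 ≼ k) ∷ (𝟘 ≼ c) ∷ [] ⊢ 𝟘 ≼ l) refl (k ∷ len e ∷ l ∷ [])
      (p , walk-nonneg w , 0⊑len e , tt)

  incident : ∀ {v l} → Walk v l → (∃[ e ] src e ≡ v) ⊎ (∃[ e ] tgt e ≡ v)
  incident (startSrc _)     = inj₁ (e₀ , refl)
  incident (startTgt _)     = inj₂ (e₀ , refl)
  incident (forward e _ _)  = inj₂ (e , refl)
  incident (backward e _ _) = inj₁ (e , refl)

  some-walk : ∀ v → ∃[ l ] Walk v l
  some-walk v = extend (connected (src e₀) v) (startSrc ⊑-refl)
    where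
    extend : ∀ {u v l} → EqClosure (λ a b → ∃[ e ] src e ≡ a × tgt e ≡ b) u v → Walk u l → ∃[ l ] Walk v l
    extend ε w = _ , w
    extend (fwd (e , refl , refl) ◅ p) w = extend p (forward e w ⊑-refl)
    extend (bwd (e , refl , refl) ◅ p) w = extend p (backward e w ⊑-refl)

  -- The last step of a walk, written with the unions, products and shifts for which truncated
  -- minima are available.
  Unfolded : Fin ∣V∣ → ℝ → Set
  Unfolded v l =
    ((src e₀ ≡ v × t₀ ⊑ l) ⊎ (tgt e₀ ≡ v × len e₀ -ᴿ t₀ ⊑ l)) ⊎
    ((∃[ e ] tgt e ≡ v × (∃[ k ] Walk (src e) k × k +ᴿ len e ⊑ l)) ⊎
     (∃[ e ] src e ≡ v × (∃[ k ] Walk (tgt e) k × k +ᴿ len e ⊑ l)))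

  fold : ∀ {v l} → Unfolded v l → Walk v l
  fold (inj₁ (inj₁ (refl , p)))             = startSrc p
  fold (inj₁ (inj₂ (refl , p)))             = startTgt p
  fold (inj₂ (inj₁ (e , refl , k , w , p))) = forward e w p
  fold (inj₂ (inj₂ (e , refl , k , w , p))) = backward e w p

  unfold : ∀ {v l} → Walk v l → Unfolded v l
  unfold (startSrc p)     = inj₁ (inj₁ (refl , p))
  unfold (startTgt p)     = inj₁ (inj₂ (refl , p))
  unfold (forward e w p)  = inj₂ (inj₁ (e , refl , _ , w , p))
  unfold (backward e w p) = inj₂ (inj₂ (e , refl , _ , w , p))

  -- Some walk to `v` has a length `l`, and some multiple n δ exceeds `l`. Hence n δ is no lower
  -- bound, and the search truncated there must have found a minimum.
  minimal-walk : ∀ v → ¬ ¬ HasMinimum (Walk v)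
  minimal-walk v =
    let δ , 0<δ , δ⊑len = common-const len len>0
        l , w = some-walk v
        n , l<nδ = archimedean 0<δ l
    in ¬¬-map (λ where
         (inj₁ low) → contradiction (low w) (<⇒≱ {l} {n ×ᴿ const δ} l<nδ)
         (inj₂ min) → min)
       (search δ⊑len n v)
    where
    -- Each edge of a walk takes at least δ, so n edges reach the bound n δ.
    search : ∀ {δ} → (∀ e → const δ ⊑ len e) → ∀ n v → ¬ ¬ MinimumBelow (n ×ᴿ const δ) (Walk v)
    search δ⊑len zero    v = pure (inj₁ λ {_} → walk-nonneg)
    search δ⊑len (suc n) v =
      minimum-∪ (minimum-× (src e₀ Fin.≟ v) (inj₂ (t₀ , ⊑-refl , id)))
                (minimum-× (tgt e₀ Fin.≟ v) (inj₂ (len e₀ -ᴿ t₀ , ⊑-refl , id)))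
      >>= λ starts →
      minimum-⋃ _ (λ e → ¬¬-map (minimum-× (tgt e Fin.≟ v) ∘ minimum-shift (δ⊑len e))
                           (search δ⊑len n (src e)))
      >>= λ forwards →
      minimum-⋃ _ (λ e → ¬¬-map (minimum-× (src e Fin.≟ v) ∘ minimum-shift (δ⊑len e))
                           (search δ⊑len n (tgt e)))
      >>= λ backwards →
      minimum-∪ forwards backwards >>= λ steps →
      ¬¬-map (minimum-⇔ fold unfold) (minimum-∪ starts steps)

  -- Double negation commutes with quantification over a finite set.
  minimal-walks : ¬ ¬ (∀ v → HasMinimum (Walk v))
  minimal-walks = Fin.sequence rawApplicative minimal-walk

  Within : Point G → Point G → ℝ → Set
  Within p q l = Σ (Path G p q) λ π → length π ⊑ l

  within-trans : ∀ {p q r k l m} → Within p q k → Within q r l → k +ᴿ l ⊑ m → Within p r m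
  within-trans (π , p) (ρ , q) k+l⊑m =
    π ◅◅ ρ , ⊑-trans (length-◅◅ π ρ) (⊑-trans (+-mono-⊑ p q) k+l⊑m)

  +0 : ∀ x → x +ᴿ 0ℝ ⊑ x
  +0 x = linear 1 (λ x → [] ⊢ x ⊕ 𝟘 ≼ x) refl (x ∷ []) tt

  along : ∀ e s t {s≥0 s≤len t≥0 t≤len} → Within (on e s s≥0 s≤len) (on e t t≥0 t≤len) (distance s t)
  along e s t = fwd (segment e s t) ◅ ε , +0 (distance s t)

  module _ (e : Fin ∣E∣) (t : ℝ) (t≥0 : 0ℝ ≤ t) (t≤len : t ≤ len e) where
    private
      p : Point G
      p = on e t t≥0 t≤len
      0≤0 : 0ℝ ≤ 0ℝ
      0≤0 = ≤-refl 0ℝ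
      len≤len : len e ≤ len e
      len≤len = ≤-refl (len e)
      t-0⊑t : t -ᴿ 0ℝ ⊑ t
      t-0⊑t = linear 1 (λ t → [] ⊢ t ⊝ 𝟘 ≼ t) refl (t ∷ []) tt
      0-t⊑t : 0ℝ -ᴿ t ⊑ t
      0-t⊑t = linear 1 (λ t → (𝟘 ≼ t) ∷ (𝟘 ≼ t) ∷ [] ⊢ 𝟘 ⊝ t ≼ t) refl (t ∷ []) (⟨ t≥0 ⟩ , ⟨ t≥0 ⟩ , tt)
      t-len⊑len-t : t -ᴿ len e ⊑ len e -ᴿ t
      t-len⊑len-t = linear 2 (λ t l → (t ≼ l) ∷ (t ≼ l) ∷ [] ⊢ t ⊝ l ≼ l ⊝ t) refl (t ∷ len e ∷ [])
        (⟨ t≤len ⟩ , ⟨ t≤len ⟩ , tt)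

    into-src : Within p (vertex (src e)) t
    into-src = within-trans (along e t 0ℝ {t≥0} {t≤len} {0≤0} {0≤len e})
      (fwd (glue-src e 0ℝ (≃-refl 0ℝ)) ◅ ε , ⊑-refl)
      (⊑-trans (+-mono-⊑ (distance-⊑ t-0⊑t 0-t⊑t) (+0 0ℝ)) (+0 t))

    from-src : Within (vertex (src e)) p t
    from-src = within-trans (bwd (glue-src e 0ℝ {0≤0} {0≤len e} (≃-refl 0ℝ)) ◅ ε , ⊑-refl)
      (along e 0ℝ t {0≤0} {0≤len e} {t≥0} {t≤len})
      (⊑-trans (+-mono-⊑ (+0 0ℝ) (distance-⊑ 0-t⊑t t-0⊑t))
        (linear 1 (λ t → [] ⊢ 𝟘 ⊕ t ≼ t) refl (t ∷ []) tt))

    into-tgt : Within p (vertex (tgt e)) (len e -ᴿ t)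
    into-tgt = within-trans (along e t (len e) {t≥0} {t≤len} {0≤len e} {len≤len})
      (fwd (glue-tgt e (len e) (≃-refl (len e))) ◅ ε , ⊑-refl)
      (⊑-trans (+-mono-⊑ (distance-⊑ t-len⊑len-t ⊑-refl) (+0 0ℝ)) (+0 _))

    from-tgt : Within (vertex (tgt e)) p (len e -ᴿ t)
    from-tgt = within-trans (bwd (glue-tgt e (len e) {0≤len e} {len≤len} (≃-refl (len e))) ◅ ε , ⊑-refl)
      (along e (len e) t {0≤len e} {len≤len} {t≥0} {t≤len})
      (⊑-trans (+-mono-⊑ (+0 0ℝ) (distance-⊑ ⊑-refl t-len⊑len-t))
        (linear 1 (λ t → [] ⊢ 𝟘 ⊕ t ≼ t) refl (len e -ᴿ t ∷ []) tt))

  traverse : ∀ e → Within (vertex (src e)) (vertex (tgt e)) (len e)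
  traverse e = within-trans
    (from-src e (len e) (0≤len e) (≤-refl (len e))) (into-tgt e (len e) (0≤len e) (≤-refl (len e)))
    (linear 1 (λ t → [] ⊢ t ⊕ (t ⊝ t) ≼ t) refl (len e ∷ []) tt)

  traverse⁻¹ : ∀ e → Within (vertex (tgt e)) (vertex (src e)) (len e)
  traverse⁻¹ e = within-trans
    (from-tgt e 0ℝ (≤-refl 0ℝ) (0≤len e)) (into-src e 0ℝ (≤-refl 0ℝ) (0≤len e))
    (linear 1 (λ t → [] ⊢ (t ⊝ 𝟘) ⊕ 𝟘 ≼ t) refl (len e ∷ []) tt)

  walk-path : ∀ {v l} → Walk v l → Within root (vertex v) l
  walk-path (startSrc p)     = let π , q = into-src e₀ t₀ _ _ in π , ⊑-trans q p
  walk-path (startTgt p)     = let π , q = into-tgt e₀ t₀ _ _ in π , ⊑-trans q p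
  walk-path (forward e w p)  = within-trans (walk-path w) (traverse e) p
  walk-path (backward e w p) = within-trans (walk-path w) (traverse⁻¹ e) p

  -- The ways to reach a point within l: a path ending inside an edge entered it
  -- at an end, or never left e₀.
  data Reach : Point G → ℝ → Set where
    at      : ∀ {v l} → Walk v l → Reach (vertex v) l
    via-src : ∀ {e t t≥0 t≤len k l} → Walk (src e) k → k +ᴿ t ⊑ l → Reach (on e t t≥0 t≤len) l
    via-tgt : ∀ {e t t≥0 t≤len k l} → Walk (tgt e) k → k +ᴿ (len e -ᴿ t) ⊑ l → Reach (on e t t≥0 t≤len) l
    direct  : ∀ {t t≥0 t≤len l} → t₀ -ᴿ t ⊑ l → t -ᴿ t₀ ⊑ l → Reach (on e₀ t t≥0 t≤len) l

  reach-path : ∀ {q l} → Reach q l → Within root q l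
  reach-path (at w)        = walk-path w
  reach-path (via-src w p) = within-trans (walk-path w) (from-src _ _ _ _) p
  reach-path (via-tgt w p) = within-trans (walk-path w) (from-tgt _ _ _ _) p
  reach-path (direct p q)  = let π , r = along e₀ _ _ in π , ⊑-trans r (distance-⊑ p q)

  -- Moving inside an edge does not change how the edge was entered; only the last stretch grows, by
  -- at most `d`. Bounding both differences by `d` lets the lemma serve a segment in either
  -- direction.
  reach-segment : ∀ {e s t s≥0 s≤len t≥0 t≤len d k l} → s -ᴿ t ⊑ d → t -ᴿ s ⊑ d →
    Reach (on e s s≥0 s≤len) k → d +ᴿ k ⊑ l → Reach (on e t t≥0 t≤len) l
  reach-segment {e} {s} {t} {d = d} {k} {l} p q (via-src {k = j} w j+s⊑k) d+k⊑l = via-src w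
    (linear 6 (λ s t d j k l → (t ⊝ s ≼ d) ∷ (j ⊕ s ≼ k) ∷ (d ⊕ k ≼ l) ∷ [] ⊢ j ⊕ t ≼ l)
      refl (s ∷ t ∷ d ∷ j ∷ k ∷ l ∷ []) (q , j+s⊑k , d+k⊑l , tt))
  reach-segment {e} {s} {t} {d = d} {k} {l} p q (via-tgt {k = j} w j+s⊑k) d+k⊑l = via-tgt w
    (linear 7 (λ s t d j k l c → (s ⊝ t ≼ d) ∷ (j ⊕ (c ⊝ s) ≼ k) ∷ (d ⊕ k ≼ l) ∷ [] ⊢ j ⊕ (c ⊝ t) ≼ l)
      refl (s ∷ t ∷ d ∷ j ∷ k ∷ l ∷ len e ∷ []) (p , j+s⊑k , d+k⊑l , tt))
  reach-segment {e} {s} {t} {d = d} {k} {l} p q (direct u v) d+k⊑l = direct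
    (linear 6 (λ s t d r k l → (s ⊝ t ≼ d) ∷ (r ⊝ s ≼ k) ∷ (d ⊕ k ≼ l) ∷ [] ⊢ r ⊝ t ≼ l)
      refl (s ∷ t ∷ d ∷ t₀ ∷ k ∷ l ∷ []) (p , u , d+k⊑l , tt))
    (linear 6 (λ s t d r k l → (t ⊝ s ≼ d) ∷ (s ⊝ r ≼ k) ∷ (d ⊕ k ≼ l) ∷ [] ⊢ t ⊝ r ≼ l)
      refl (s ∷ t ∷ d ∷ t₀ ∷ k ∷ l ∷ []) (q , v , d+k⊑l , tt))

  -- At the source, an edge entered there has been left again at no gain, an edge entered at its
  -- target has been crossed whole, and a path that never left `e₀` is the start of a walk.
  at-src : ∀ {e t t≥0 t≤len k l} → t ≈ 0ℝ → Reach (on e t t≥0 t≤len) k → 0ℝ +ᴿ k ⊑ l → Walk (src e) l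
  at-src {e} {t} {k = k} {l} t≈0 (via-src {k = j} w p) k⊑l = Walk-⊑ w
    (linear 4 (λ t j k l → (𝟘 ≼ t) ∷ (j ⊕ t ≼ k) ∷ (𝟘 ⊕ k ≼ l) ∷ [] ⊢ j ≼ l)
      refl (t ∷ j ∷ k ∷ l ∷ []) (≈⇒⊒ t≈0 , p , k⊑l , tt))
  at-src {e} {t} {k = k} {l} t≈0 (via-tgt {k = j} w p) k⊑l = backward e w
    (linear 5 (λ t j k l c → (t ≼ 𝟘) ∷ (j ⊕ (c ⊝ t) ≼ k) ∷ (𝟘 ⊕ k ≼ l) ∷ [] ⊢ j ⊕ c ≼ l)
      refl (t ∷ j ∷ k ∷ l ∷ len e ∷ []) (≈⇒⊑ t≈0 , p , k⊑l , tt))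
  at-src {e} {t} {k = k} {l} t≈0 (direct p q) k⊑l = startSrc
    (linear 4 (λ t k l r → (t ≼ 𝟘) ∷ (r ⊝ t ≼ k) ∷ (𝟘 ⊕ k ≼ l) ∷ [] ⊢ r ≼ l)
      refl (t ∷ k ∷ l ∷ t₀ ∷ []) (≈⇒⊑ t≈0 , p , k⊑l , tt))

  at-tgt : ∀ {e t t≥0 t≤len k l} → t ≈ len e → Reach (on e t t≥0 t≤len) k → 0ℝ +ᴿ k ⊑ l → Walk (tgt e) l
  at-tgt {e} {t} {k = k} {l} t≈len (via-src {k = j} w p) k⊑l = forward e w
    (linear 5 (λ t j k l c → (c ≼ t) ∷ (j ⊕ t ≼ k) ∷ (𝟘 ⊕ k ≼ l) ∷ [] ⊢ j ⊕ c ≼ l)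
      refl (t ∷ j ∷ k ∷ l ∷ len e ∷ []) (≈⇒⊒ t≈len , p , k⊑l , tt))
  at-tgt {e} {t} {k = k} {l} t≈len (via-tgt {k = j} w p) k⊑l = Walk-⊑ w
    (linear 5 (λ t j k l c → (t ≼ c) ∷ (j ⊕ (c ⊝ t) ≼ k) ∷ (𝟘 ⊕ k ≼ l) ∷ [] ⊢ j ≼ l)
      refl (t ∷ j ∷ k ∷ l ∷ len e ∷ []) (≈⇒⊑ t≈len , p , k⊑l , tt))
  at-tgt {e} {t} {k = k} {l} t≈len (direct p q) k⊑l = startTgt
    (linear 5 (λ t k l r c → (c ≼ t) ∷ (t ⊝ r ≼ k) ∷ (𝟘 ⊕ k ≼ l) ∷ [] ⊢ c ⊝ r ≼ l)
      refl (t ∷ k ∷ l ∷ t₀ ∷ len e₀ ∷ []) (≈⇒⊒ t≈len , q , k⊑l , tt))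

  reach-step : ∀ {p q k l} (s : Step G p q) → Reach p k → stepLength′ s +ᴿ k ⊑ l → Reach q l
  reach-step (segment e s t)    reach     d+k⊑l = reach-segment (x-y⊑distance s t) (y-x⊑distance s t) reach d+k⊑l
  reach-step (glue-src e t t≃0) reach     k⊑l   = at (at-src (≃⇒≈ t≃0) reach k⊑l)
  reach-step (glue-tgt e t t≃l) reach     k⊑l   = at (at-tgt (≃⇒≈ t≃l) reach k⊑l)

  reach-step⁻¹ : ∀ {p q k l} (s : Step G p q) → Reach q k → stepLength′ s +ᴿ k ⊑ l → Reach p l
  reach-step⁻¹ (segment e s t)    reach  d+k⊑l = reach-segment (y-x⊑distance s t) (x-y⊑distance s t) reach d+k⊑l
  reach-step⁻¹ {k = k} {l} (glue-src e t t≃0) (at w) k⊑l = via-src w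
    (linear 3 (λ t k l → (t ≼ 𝟘) ∷ (𝟘 ⊕ k ≼ l) ∷ [] ⊢ k ⊕ t ≼ l) refl (t ∷ k ∷ l ∷ []) (⟨ proj₁ t≃0 ⟩ , k⊑l , tt))
  reach-step⁻¹ {k = k} {l} (glue-tgt e t t≃l) (at w) k⊑l = via-tgt w
    (linear 4 (λ t k l c → (c ≼ t) ∷ (𝟘 ⊕ k ≼ l) ∷ [] ⊢ k ⊕ (c ⊝ t) ≼ l) refl (t ∷ k ∷ l ∷ len e ∷ [])
      (⟨ proj₂ t≃l ⟩ , k⊑l , tt))

  reach-⊑ : ∀ {q k l} → Reach q k → k ⊑ l → Reach q l
  reach-⊑ (at w)        k⊑l = at (Walk-⊑ w k⊑l)
  reach-⊑ (via-src w p) k⊑l = via-src w (⊑-trans p k⊑l)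
  reach-⊑ (via-tgt w p) k⊑l = via-tgt w (⊑-trans p k⊑l)
  reach-⊑ (direct p q)  k⊑l = direct (⊑-trans p k⊑l) (⊑-trans q k⊑l)

  -- The length `k` already covered accumulates along the path. Together with `reach-path` this
  -- reduces arbitrary paths, which may turn around inside edges, to walks.
  path-reach : ∀ {p q k l} (π : Path G p q) → Reach p k → k +ᴿ length π ⊑ l → Reach q l
  path-reach {k = k} ε reach k+0⊑l = reach-⊑ reach (⊑-trans (linear 1 (λ k → [] ⊢ k ≼ k ⊕ 𝟘) refl (k ∷ []) tt) k+0⊑l)
  path-reach {k = k} {l} (fwd s ◅ π) reach p = path-reach π (reach-step s reach ⊑-refl)
    (⊑-trans (linear 3 (λ k s p → [] ⊢ (s ⊕ k) ⊕ p ≼ k ⊕ (s ⊕ p)) refl (k ∷ stepLength′ s ∷ length π ∷ []) tt) p)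
  path-reach {k = k} {l} (bwd s ◅ π) reach p = path-reach π (reach-step⁻¹ s reach ⊑-refl)
    (⊑-trans (linear 3 (λ k s p → [] ⊢ (s ⊕ k) ⊕ p ≼ k ⊕ (s ⊕ p)) refl (k ∷ stepLength′ s ∷ length π ∷ []) tt) p)

  root-path-reach : ∀ {q} (π : Path G root q) → Reach q (length π)
  root-path-reach π = path-reach π (direct t₀-t₀⊑0 t₀-t₀⊑0)
    (linear 1 (λ x → [] ⊢ 𝟘 ⊕ x ≼ x) refl (length π ∷ []) tt)
    where
    t₀-t₀⊑0 : t₀ -ᴿ t₀ ⊑ 0ℝ
    t₀-t₀⊑0 = linear 1 (λ t → [] ⊢ t ⊝ t ≼ 𝟘) refl (t₀ ∷ []) tt

  -- `reach-path` gives a path of length at most `d`; applying minimality to that very path shows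
  -- that its length is `d`.
  reach-distance : ∀ {q d} → Reach q d → (∀ l → Reach q l → d ⊑ l) → IsDistance G root q d
  reach-distance {q} {d} reach low =
    let π , π⊑d = reach-path reach in
    (π , subst (_≃ d) (sym (length-def π)) (≈⇒≃ (π⊑d , low _ (root-path-reach π)))) ,
    λ z (ρ , ρ≃z) → ⊑⇒≤ (⊑-trans (low _ (root-path-reach ρ)) (subst (_⊑ z) (length-def ρ) ⟨ proj₁ ρ≃z ⟩))

-- The length bound

count>0 : ∀ {A : Set} {P : A → Set} (P? : Decidable P) {n} (f : Fin n → A) i → P (f i) →
  0 ℕ.< Vec.count P? (Vec.tabulate f)
count>0 P? {suc n} f i p with P? (f zero)
count>0 P? {suc n} f i       p | yes _  = ℕ.z<s
count>0 P? {suc n} f zero    p | no ¬p  = contradiction p ¬p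
count>0 P? {suc n} f (suc i) p | no _   = count>0 P? (f ∘ suc) i p

multiple-nonneg : ∀ n {x} → 0ℝ ⊑ x → 0ℝ ⊑ n ×ᴿ x
multiple-nonneg zero        0⊑x = ⊑-refl
multiple-nonneg (suc n) {x} 0⊑x = linear 2 (λ x y → (𝟘 ≼ x) ∷ (𝟘 ≼ y) ∷ [] ⊢ 𝟘 ≼ x ⊕ y)
  refl (x ∷ n ×ᴿ x ∷ []) (0⊑x , multiple-nonneg n 0⊑x , tt)

module Potential (G : MetricGraph) (e₀ : Fin (MetricGraph.∣E∣ G)) (t₀ : ℝ)
  (0⊑t₀ : 0ℝ ⊑ t₀) (t₀⊑len : t₀ ⊑ MetricGraph.len G e₀)
  (minima : ∀ v → HasMinimum (Rooted.Walk G e₀ t₀ 0⊑t₀ t₀⊑len v))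
  (r : ℝ) (bounded : ∀ q d → IsDistance G (Rooted.root G e₀ t₀ 0⊑t₀ t₀⊑len) q d → d ≤ r)
  where

  open MetricGraph G
  open Rooted G e₀ t₀ 0⊑t₀ t₀⊑len

  a : Fin ∣V∣ → ℝ
  a v = proj₁ (minima v)

  a-walk : ∀ v → Walk v (a v)
  a-walk v = proj₁ (proj₂ (minima v))

  a-least : ∀ {v l} → Walk v l → a v ⊑ l
  a-least {v} w = proj₂ (proj₂ (minima v)) w

  a-nonneg : ∀ v → 0ℝ ⊑ a v
  a-nonneg v = walk-nonneg (a-walk v)

  within-radius : ∀ {q d} → Reach q d → (∀ l → Reach q l → d ⊑ l) → d ⊑ r
  within-radius {q} {d} reach low = ⟨ bounded q d (reach-distance reach low) ⟩

  a⊑r : ∀ v → a v ⊑ r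
  a⊑r v = within-radius (at (a-walk v)) λ _ → λ { (at w) → a-least w }

  a-src⊑ : ∀ e → a (src e) ⊑ a (tgt e) +ᴿ len e
  a-src⊑ e = a-least (backward e (a-walk (tgt e)) ⊑-refl)

  a-tgt⊑ : ∀ e → a (tgt e) ⊑ a (src e) +ᴿ len e
  a-tgt⊑ e = a-least (forward e (a-walk (src e)) ⊑-refl)

  edge-bound : ∀ e → e ≢ e₀ → a (src e) +ᴿ a (tgt e) +ᴿ len e ⊑ r +ᴿ r
  edge-bound e e≢e₀ = linear 5
    (λ s t c m r → (c ⊕ t ⊝ s ≼ m ⊕ m) ∷ (s ⊕ m ≼ r) ∷ (s ⊕ m ≼ r) ∷ [] ⊢ s ⊕ t ⊕ c ≼ r ⊕ r)
    refl (aₛ ∷ aₜ ∷ len e ∷ m ∷ r ∷ [])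
    (≈⇒⊒ m+m , far , far , tt)
    where
    aₛ aₜ m : ℝ
    aₛ = a (src e)
    aₜ = a (tgt e)
    -- The balance point, where both routes are equally long: `aₛ` + m = `aₜ` + (`len e` - m). The
    -- triangle inequalities place it on the edge.
    m  = half (len e +ᴿ aₜ -ᴿ aₛ)
    m+m : m +ᴿ m ≈ len e +ᴿ aₜ -ᴿ aₛ
    m+m = half+half _
    0⊑m : 0ℝ ⊑ m
    0⊑m = halve-⊑ (linear 4 (λ s t c m → (c ⊕ t ⊝ s ≼ m ⊕ m) ∷ (s ≼ t ⊕ c) ∷ [] ⊢ 𝟘 ⊕ 𝟘 ≼ m ⊕ m)
      refl (aₛ ∷ aₜ ∷ len e ∷ m ∷ []) (≈⇒⊒ m+m , a-src⊑ e , tt))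
    m⊑len : m ⊑ len e
    m⊑len = halve-⊑ (linear 4 (λ s t c m → (m ⊕ m ≼ c ⊕ t ⊝ s) ∷ (t ≼ s ⊕ c) ∷ [] ⊢ m ⊕ m ≼ c ⊕ c)
      refl (aₛ ∷ aₜ ∷ len e ∷ m ∷ []) (≈⇒⊑ m+m , a-tgt⊑ e , tt))
    far : aₛ +ᴿ m ⊑ r
    far = within-radius {on e m (⊑⇒≤ 0⊑m) (⊑⇒≤ m⊑len)} (via-src (a-walk (src e)) ⊑-refl) λ where
      l (via-src {k = k} w p) → linear 4 (λ s m k l → (s ≼ k) ∷ (k ⊕ m ≼ l) ∷ [] ⊢ s ⊕ m ≼ l)
        refl (aₛ ∷ m ∷ k ∷ l ∷ []) (a-least w , p , tt)
      l (via-tgt {k = k} w p) → linear 6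
        (λ s t c m k l → (m ⊕ m ≼ c ⊕ t ⊝ s) ∷ (t ≼ k) ∷ (k ⊕ (c ⊝ m) ≼ l) ∷ [] ⊢ s ⊕ m ≼ l)
        refl (aₛ ∷ aₜ ∷ len e ∷ m ∷ k ∷ l ∷ []) (≈⇒⊑ m+m , a-least w , p , tt)
      _ (direct _ _) → contradiction refl e≢e₀

  private
    aₛ aₜ : ℝ
    aₛ = a (src e₀)
    aₜ = a (tgt e₀)

  src-bound : aₛ +ᴿ t₀ ⊑ r +ᴿ r
  src-bound = linear 4
    (λ s t m r → (t ⊝ s ≼ m ⊕ m) ∷ (s ⊕ m ≼ r) ∷ (s ⊕ m ≼ r) ∷ [] ⊢ s ⊕ t ≼ r ⊕ r)
    refl (aₛ ∷ t₀ ∷ m ∷ r ∷ []) (≈⇒⊒ m+m , far , far , tt)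
    where
    m : ℝ
    -- Here the route through the source balances the direct one: `aₛ` + m = `t₀` - m.
    m = half (t₀ -ᴿ aₛ)
    m+m : m +ᴿ m ≈ t₀ -ᴿ aₛ
    m+m = half+half _
    0⊑m : 0ℝ ⊑ m
    0⊑m = halve-⊑ (linear 3 (λ s t m → (t ⊝ s ≼ m ⊕ m) ∷ (s ≼ t) ∷ [] ⊢ 𝟘 ⊕ 𝟘 ≼ m ⊕ m)
      refl (aₛ ∷ t₀ ∷ m ∷ []) (≈⇒⊒ m+m , a-least (startSrc ⊑-refl) , tt))
    m⊑len : m ⊑ len e₀
    m⊑len = halve-⊑ (linear 4
      (λ s t c m → (m ⊕ m ≼ t ⊝ s) ∷ (𝟘 ≼ s) ∷ (𝟘 ≼ t) ∷ (t ≼ c) ∷ (t ≼ c) ∷ [] ⊢ m ⊕ m ≼ c ⊕ c)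
      refl (aₛ ∷ t₀ ∷ len e₀ ∷ m ∷ []) (≈⇒⊑ m+m , a-nonneg _ , 0⊑t₀ , t₀⊑len , t₀⊑len , tt))
    far : aₛ +ᴿ m ⊑ r
    far = within-radius {on e₀ m (⊑⇒≤ 0⊑m) (⊑⇒≤ m⊑len)} (via-src (a-walk (src e₀)) ⊑-refl) λ where
      l (via-src {k = k} w p) → linear 4 (λ s m k l → (s ≼ k) ∷ (k ⊕ m ≼ l) ∷ [] ⊢ s ⊕ m ≼ l)
        refl (aₛ ∷ m ∷ k ∷ l ∷ []) (a-least w , p , tt)
      -- A route through the target covers at least `len e₀` - m, which is no shorter than the
      -- direct `t₀` - m.
      l (via-tgt {k = k} w p) → linear 6
        (λ s t c m k l → (m ⊕ m ≼ t ⊝ s) ∷ (𝟘 ≼ k) ∷ (t ≼ c) ∷ (k ⊕ (c ⊝ m) ≼ l) ∷ [] ⊢ s ⊕ m ≼ l)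
        refl (aₛ ∷ t₀ ∷ len e₀ ∷ m ∷ k ∷ l ∷ []) (≈⇒⊑ m+m , walk-nonneg w , t₀⊑len , p , tt)
      l (direct p _) → linear 4 (λ s t m l → (m ⊕ m ≼ t ⊝ s) ∷ (t ⊝ m ≼ l) ∷ [] ⊢ s ⊕ m ≼ l)
        refl (aₛ ∷ t₀ ∷ m ∷ l ∷ []) (≈⇒⊑ m+m , p , tt)

  tgt-bound : aₜ +ᴿ (len e₀ -ᴿ t₀) ⊑ r +ᴿ r
  tgt-bound = linear 5
    (λ s t c m r → (m ⊕ m ≼ c ⊕ s ⊕ t) ∷ (s ⊕ (c ⊝ m) ≼ r) ∷ (s ⊕ (c ⊝ m) ≼ r) ∷ [] ⊢ s ⊕ (c ⊝ t) ≼ r ⊕ r)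
    refl (aₜ ∷ t₀ ∷ len e₀ ∷ m ∷ r ∷ []) (≈⇒⊑ m+m , far , far , tt)
    where
    m : ℝ
    -- The balance point beyond the root: `aₜ` + (`len e₀` - m) = m - `t₀`.
    m = half (len e₀ +ᴿ aₜ +ᴿ t₀)
    m+m : m +ᴿ m ≈ len e₀ +ᴿ aₜ +ᴿ t₀
    m+m = half+half _
    0⊑m : 0ℝ ⊑ m
    0⊑m = halve-⊑ (linear 4
      (λ s t c m → (c ⊕ s ⊕ t ≼ m ⊕ m) ∷ (𝟘 ≼ s) ∷ (𝟘 ≼ t) ∷ (𝟘 ≼ c) ∷ [] ⊢ 𝟘 ⊕ 𝟘 ≼ m ⊕ m)
      refl (aₜ ∷ t₀ ∷ len e₀ ∷ m ∷ []) (≈⇒⊒ m+m , a-nonneg _ , 0⊑t₀ , 0⊑len e₀ , tt))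
    m⊑len : m ⊑ len e₀
    m⊑len = halve-⊑ (linear 4 (λ s t c m → (m ⊕ m ≼ c ⊕ s ⊕ t) ∷ (s ≼ c ⊝ t) ∷ [] ⊢ m ⊕ m ≼ c ⊕ c)
      refl (aₜ ∷ t₀ ∷ len e₀ ∷ m ∷ []) (≈⇒⊑ m+m , a-least (startTgt ⊑-refl) , tt))
    far : aₜ +ᴿ (len e₀ -ᴿ m) ⊑ r
    far = within-radius {on e₀ m (⊑⇒≤ 0⊑m) (⊑⇒≤ m⊑len)} (via-tgt (a-walk (tgt e₀)) ⊑-refl) λ where
      l (via-src {k = k} w p) → linear 6
        (λ s t c m k l → (c ⊕ s ⊕ t ≼ m ⊕ m) ∷ (𝟘 ≼ k) ∷ (𝟘 ≼ t) ∷ (k ⊕ m ≼ l) ∷ [] ⊢ s ⊕ (c ⊝ m) ≼ l)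
        refl (aₜ ∷ t₀ ∷ len e₀ ∷ m ∷ k ∷ l ∷ []) (≈⇒⊒ m+m , walk-nonneg w , 0⊑t₀ , p , tt)
      l (via-tgt {k = k} w p) → linear 5 (λ s c m k l → (s ≼ k) ∷ (k ⊕ (c ⊝ m) ≼ l) ∷ [] ⊢ s ⊕ (c ⊝ m) ≼ l)
        refl (aₜ ∷ len e₀ ∷ m ∷ k ∷ l ∷ []) (a-least w , p , tt)
      l (direct _ p) → linear 5 (λ s t c m l → (c ⊕ s ⊕ t ≼ m ⊕ m) ∷ (m ⊝ t ≼ l) ∷ [] ⊢ s ⊕ (c ⊝ m) ≼ l)
        refl (aₜ ∷ t₀ ∷ len e₀ ∷ m ∷ l ∷ []) (≈⇒⊒ m+m , p , tt)

  -- The root splits e₀ into two edges: zero is the part at tgt e₀, and suc e₀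
  -- stands for the part at src e₀.
  data Parent : Fin ∣V∣ → Fin (suc ∣E∣) → Set where
    root-tgt : len e₀ -ᴿ t₀ ⊑ aₜ → Parent (tgt e₀) zero
    root-src : t₀ ⊑ aₛ → Parent (src e₀) (suc e₀)
    edge-tgt : ∀ {e} → e ≢ e₀ → a (src e) +ᴿ len e ⊑ a (tgt e) → Parent (tgt e) (suc e)
    edge-src : ∀ {e} → e ≢ e₀ → a (tgt e) +ᴿ len e ⊑ a (src e) → Parent (src e) (suc e)

  -- The last step of a shortest walk is tight: the walk before it is at least as long as `a` at the
  -- other end, so that value plus the edge length is at most `a v`.
  parent : ∀ v → ∃[ i ] Parent v i
  parent v = last-edge (a-walk v) ⊑-refl
    where
    last-edge : ∀ {v l} → Walk v l → l ⊑ a v → ∃[ i ] Parent v i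
    last-edge (startSrc p) l⊑a = suc e₀ , root-src (⊑-trans p l⊑a)
    last-edge (startTgt p) l⊑a = zero , root-tgt (⊑-trans p l⊑a)
    last-edge (forward e {k} {l} w p) l⊑a with e Fin.≟ e₀
    ... | no e≢e₀  = suc e , edge-tgt e≢e₀ (⊑-trans (+-mono-⊑ (a-least w) ⊑-refl) (⊑-trans p l⊑a))
    -- Crossing the whole of `e₀` costs at least as much as its part beyond the root, so this part
    -- can serve as the parent; the backward case is symmetric.
    ... | yes refl = zero , root-tgt (linear 5
      (λ t c k l s → (𝟘 ≼ t) ∷ (𝟘 ≼ k) ∷ (k ⊕ c ≼ l) ∷ (l ≼ s) ∷ [] ⊢ c ⊝ t ≼ s)
      refl (t₀ ∷ len e₀ ∷ k ∷ l ∷ aₜ ∷ []) (0⊑t₀ , walk-nonneg w , p , l⊑a , tt))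
    last-edge (backward e {k} {l} w p) l⊑a with e Fin.≟ e₀
    ... | no e≢e₀  = suc e , edge-src e≢e₀ (⊑-trans (+-mono-⊑ (a-least w) ⊑-refl) (⊑-trans p l⊑a))
    ... | yes refl = suc e₀ , root-src (linear 5
      (λ t c k l s → (t ≼ c) ∷ (𝟘 ≼ k) ∷ (k ⊕ c ≼ l) ∷ (l ≼ s) ∷ [] ⊢ t ≼ s)
      refl (t₀ ∷ len e₀ ∷ k ∷ l ∷ aₛ ∷ []) (t₀⊑len , walk-nonneg w , p , l⊑a , tt))

  two-way : ∀ e → a (src e) +ᴿ len e ⊑ a (tgt e) → ¬ a (tgt e) +ᴿ len e ⊑ a (src e)
  two-way e p q = <⇒≱ {0ℝ} {len e} (len>0 e) (halve-⊑ (linear 3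
    (λ s t c → (s ⊕ c ≼ t) ∷ (t ⊕ c ≼ s) ∷ [] ⊢ c ⊕ c ≼ 𝟘 ⊕ 𝟘) refl (a (src e) ∷ a (tgt e) ∷ len e ∷ [])
    (p , q , tt)))

  -- The only possible clash is an edge tight towards both of its ends. Adding the two inequalities
  -- would make its length nonpositive, which `two-way` refutes.
  parent-injective : ∀ {v w i} → Parent v i → Parent w i → v ≡ w
  parent-injective (root-tgt _)   (root-tgt _)   = refl
  parent-injective (root-src _)   (root-src _)   = refl
  parent-injective (root-src _)   (edge-tgt e≢ _) = contradiction refl e≢
  parent-injective (root-src _)   (edge-src e≢ _) = contradiction refl e≢
  parent-injective (edge-tgt e≢ _) (root-src _)   = contradiction refl e≢
  parent-injective (edge-src e≢ _) (root-src _)   = contradiction refl e≢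
  parent-injective (edge-tgt _ _) (edge-tgt _ _) = refl
  parent-injective (edge-src _ _) (edge-src _ _) = refl
  parent-injective {i = suc e} (edge-tgt _ p) (edge-src _ q) = contradiction q (two-way e p)
  parent-injective {i = suc e} (edge-src _ q) (edge-tgt _ p) = contradiction q (two-way e p)

  tgt-part : ℝ
  tgt-part = aₜ +ᴿ (len e₀ -ᴿ t₀)

  -- Twice the amount by which the radius exceeds the distance from the root
  -- to the farthest point of an edge.  For e = e₀ the last summand leaves
  -- r + r - (aₛ + t₀).
  slack : Fin (suc ∣E∣) → ℝ
  slack zero    = r +ᴿ r -ᴿ tgt-part
  slack (suc e) = (r +ᴿ r -ᴿ (a (src e) +ᴿ a (tgt e) +ᴿ len e)) +ᴿ (tgt-part when e₀ Fin.≟ e)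

  slack-nonneg : ∀ i → 0ℝ ⊑ slack i
  slack-nonneg zero = linear 2 (λ c r → (c ≼ r ⊕ r) ∷ [] ⊢ 𝟘 ≼ r ⊕ r ⊝ c) refl (tgt-part ∷ r ∷ []) (tgt-bound , tt)
  slack-nonneg (suc e) with e₀ Fin.≟ e
  ... | yes refl = linear 5
    (λ s t u c r → (s ⊕ u ≼ r ⊕ r) ∷ [] ⊢ 𝟘 ≼ (r ⊕ r ⊝ (s ⊕ t ⊕ c)) ⊕ (t ⊕ (c ⊝ u)))
    refl (aₛ ∷ aₜ ∷ t₀ ∷ len e₀ ∷ r ∷ []) (src-bound , tt)
  ... | no e₀≢e = linear 4
    (λ s t c r → (s ⊕ t ⊕ c ≼ r ⊕ r) ∷ [] ⊢ 𝟘 ≼ (r ⊕ r ⊝ (s ⊕ t ⊕ c)) ⊕ 𝟘)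
    refl (a (src e) ∷ a (tgt e) ∷ len e ∷ r ∷ []) (edge-bound e (e₀≢e ∘ sym) , tt)

  -- Tightness bounds the distance at the other end plus the length by `a v`, so what the slack
  -- subtracts from `r +ᴿ r` is at most `a v +ᴿ a v`. For the two parts of `e₀` the other end is the
  -- root, at distance zero.
  parent-slack : ∀ {v i} → Parent v i → r +ᴿ r -ᴿ (a v +ᴿ a v) ⊑ slack i
  parent-slack (root-tgt p) = linear 3 (λ s c r → (c ≼ s) ∷ [] ⊢ r ⊕ r ⊝ (s ⊕ s) ≼ r ⊕ r ⊝ (s ⊕ c))
    refl (aₜ ∷ len e₀ -ᴿ t₀ ∷ r ∷ []) (p , tt)
  parent-slack (root-src p) with e₀ Fin.≟ e₀
  ... | no e₀≢e₀ = contradiction refl e₀≢e₀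
  ... | yes _ = linear 5
    (λ s t u c r → (u ≼ s) ∷ [] ⊢ r ⊕ r ⊝ (s ⊕ s) ≼ (r ⊕ r ⊝ (s ⊕ t ⊕ c)) ⊕ (t ⊕ (c ⊝ u)))
    refl (aₛ ∷ aₜ ∷ t₀ ∷ len e₀ ∷ r ∷ []) (p , tt)
  parent-slack (edge-tgt {e} e≢e₀ p) with e₀ Fin.≟ e
  ... | yes refl = contradiction refl e≢e₀
  ... | no _ = linear 4
    (λ s t c r → (s ⊕ c ≼ t) ∷ [] ⊢ r ⊕ r ⊝ (t ⊕ t) ≼ (r ⊕ r ⊝ (s ⊕ t ⊕ c)) ⊕ 𝟘)
    refl (a (src e) ∷ a (tgt e) ∷ len e ∷ r ∷ []) (p , tt)
  parent-slack (edge-src {e} e≢e₀ p) with e₀ Fin.≟ e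
  ... | yes refl = contradiction refl e≢e₀
  ... | no _ = linear 4
    (λ s t c r → (t ⊕ c ≼ s) ∷ [] ⊢ r ⊕ r ⊝ (s ⊕ s) ≼ (r ⊕ r ⊝ (s ⊕ t ⊕ c)) ⊕ 𝟘)
    refl (a (src e) ∷ a (tgt e) ∷ len e ∷ r ∷ []) (p , tt)

  -- The correction at `e₀` contributes `tgt-part` exactly once, which cancels the `tgt-part`
  -- subtracted in `slack zero`.
  slack-sum : Σᴿ slack +ᴿ Σᴿ (a ∘ src) +ᴿ Σᴿ (a ∘ tgt) +ᴿ Σᴿ len ⊑ suc ∣E∣ ×ᴿ (r +ᴿ r)
  slack-sum = linear 7 (λ g s t c k p m → (g ⊕ (s ⊕ t ⊕ c) ≼ m ⊕ k) ∷ [] ⊢ (p ⊝ k) ⊕ g ⊕ s ⊕ t ⊕ c ≼ p ⊕ m)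
    refl (Σᴿ (slack ∘ suc) ∷ Σᴿ (a ∘ src) ∷ Σᴿ (a ∘ tgt) ∷ Σᴿ len ∷ tgt-part ∷ r +ᴿ r ∷ ∣E∣ ×ᴿ (r +ᴿ r) ∷ [])
    (≈⇒⊑ rest , tt)
    where
    load : Fin ∣E∣ → ℝ
    load e = a (src e) +ᴿ a (tgt e) +ᴿ len e
    Σ-load : Σᴿ load ≈ Σᴿ (a ∘ src) +ᴿ Σᴿ (a ∘ tgt) +ᴿ Σᴿ len
    Σ-load = ≈-trans (∑-distrib-+ (λ e → a (src e) +ᴿ a (tgt e)) len)
      (+-mono-≈ (∑-distrib-+ (a ∘ src) (a ∘ tgt)) ≈-refl)
    rest : Σᴿ (slack ∘ suc) +ᴿ (Σᴿ (a ∘ src) +ᴿ Σᴿ (a ∘ tgt) +ᴿ Σᴿ len) ≈ ∣E∣ ×ᴿ (r +ᴿ r) +ᴿ tgt-part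
    rest = ≈-trans (+-mono-≈ ≈-refl (≈-sym Σ-load))
      (≈-trans (≈-sym (∑-distrib-+ (slack ∘ suc) load))
      (≈-trans (sum-cong-≋ λ e → equation 3 (λ p l w → (p ⊝ l) ⊕ w ⊕ l , p ⊕ w) refl refl
                 (r +ᴿ r ∷ load e ∷ (tgt-part when e₀ Fin.≟ e) ∷ []))
      (≈-trans (∑-distrib-+ (λ _ → r +ᴿ r) (λ e → tgt-part when e₀ Fin.≟ e))
      (+-mono-≈ (sum-replicate ∣E∣) (Σ-when-≡ (λ _ → tgt-part) e₀)))))

  degree-bound : ∀ v → a v +ᴿ a v ⊑ degree G v ×ᴿ a v +ᴿ (r when degree G v ℕ.≟ 1)
  degree-bound v = bound (degree G v) (a-nonneg v) (a⊑r v) degree>0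
    where
    -- A walk to `v` ends with an edge, or a part of `e₀`, that has an end at `v`; this excludes
    -- degree zero.
    degree>0 : 0 ℕ.< degree G v
    degree>0 = [ (λ (e , eq) → ℕ.≤-trans (count>0 (λ e → src e Fin.≟ v) id e eq) (ℕ.m≤m+n _ _))
               , (λ (e , eq) → ℕ.≤-trans (count>0 (λ e → tgt e Fin.≟ v) id e eq) (ℕ.m≤n+m _ _)) ]′
               (incident (a-walk v))
    bound : ∀ d {x} → 0ℝ ⊑ x → x ⊑ r → 0 ℕ.< d → x +ᴿ x ⊑ d ×ᴿ x +ᴿ (r when d ℕ.≟ 1)
    bound 1             {x} 0⊑x x⊑r _ = linear 2 (λ x r → (x ≼ r) ∷ [] ⊢ x ⊕ x ≼ (x ⊕ 𝟘) ⊕ r)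
      refl (x ∷ r ∷ []) (x⊑r , tt)
    bound (suc (suc d)) {x} 0⊑x x⊑r _ = linear 2 (λ x y → (𝟘 ≼ y) ∷ [] ⊢ x ⊕ x ≼ (x ⊕ (x ⊕ y)) ⊕ 𝟘)
      refl (x ∷ d ×ᴿ x ∷ []) (multiple-nonneg d 0⊑x , tt)

  degree-sum : Σᴿ (λ v → a v +ᴿ a v) ⊑ Σᴿ (a ∘ src) +ᴿ Σᴿ (a ∘ tgt) +ᴿ leaves G ×ᴿ r
  degree-sum = ⊑-trans (Σ-mono degree-bound) (≈⇒⊑
    (≈-trans (∑-distrib-+ (λ v → degree G v ×ᴿ a v) (λ v → r when degree G v ℕ.≟ 1))
    (+-mono-≈
      (≈-trans (sum-cong-≋ λ v → ×ᴿ-homo-+ (a v) (#src v) (#tgt v))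
      (≈-trans (∑-distrib-+ (λ v → #src v ×ᴿ a v) (λ v → #tgt v ×ᴿ a v))
      (+-mono-≈ (Σ-count src a) (Σ-count tgt a))))
      (≈-sym (count-×ᴿ (λ v → degree G v ℕ.≟ 1) id r)))))
    where
    #src #tgt : Fin ∣V∣ → ℕ
    #src v = Vec.count (λ e → src e Fin.≟ v) (Vec.allFin ∣E∣)
    #tgt v = Vec.count (λ e → tgt e Fin.≟ v) (Vec.allFin ∣E∣)

  -- The sums over `a` cancel between `degree-sum` and `slack-sum`. Keeping the vertex and edge
  -- counts on opposite sides leaves only natural multiples.
  length-bound : ∣V∣ ×ᴿ (r +ᴿ r) +ᴿ Σᴿ len ⊑ suc ∣E∣ ×ᴿ (r +ᴿ r) +ᴿ leaves G ×ᴿ r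
  length-bound = linear 9
    (λ f g p s t c q u l → (f ≼ g) ∷ (q ≼ f ⊕ p) ∷ (p ≼ s ⊕ t ⊕ l) ∷ (g ⊕ s ⊕ t ⊕ c ≼ u) ∷ []
       ⊢ q ⊕ c ≼ u ⊕ l)
    refl (Σᴿ gap ∷ Σᴿ slack ∷ Σᴿ (λ v → a v +ᴿ a v) ∷ Σᴿ (a ∘ src) ∷ Σᴿ (a ∘ tgt) ∷ Σᴿ len
      ∷ ∣V∣ ×ᴿ (r +ᴿ r) ∷ suc ∣E∣ ×ᴿ (r +ᴿ r) ∷ leaves G ×ᴿ r ∷ [])
    (gap⊑slack , ≈⇒⊑ gap-sum , degree-sum , slack-sum , tt)
    where
    gap : Fin ∣V∣ → ℝ
    gap v = r +ᴿ r -ᴿ (a v +ᴿ a v)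
    gap⊑slack : Σᴿ gap ⊑ Σᴿ slack
    gap⊑slack = ⊑-trans (Σ-mono λ v → parent-slack (proj₂ (parent v)))
      (Σ-injection (proj₁ ∘ parent) (λ v w eq → parent-injective (proj₂ (parent v))
        (subst (Parent w) (sym eq) (proj₂ (parent w)))) slack slack-nonneg)
    gap-sum : ∣V∣ ×ᴿ (r +ᴿ r) ≈ Σᴿ gap +ᴿ Σᴿ (λ v → a v +ᴿ a v)
    gap-sum = ≈-trans (≈-sym (sum-replicate ∣V∣))
      (≈-trans (sum-cong-≋ λ v → equation 2 (λ p q → p , (p ⊝ q) ⊕ q) refl refl (r +ᴿ r ∷ a v +ᴿ a v ∷ []))
        (∑-distrib-+ gap λ v → a v +ᴿ a v))

-- Integer multiples and the cyclomatic number

⊖-· : ∀ m n x → (m ⊖ n) · x +ᴿ n ×ᴿ x ≈ m ×ᴿ x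
⊖-· m       zero    x = ≈-trans (≈-reflexive (cong (_+ᴿ 0ℝ) (×ᴿ-def m x)))
  (equation 1 (λ y → y ⊕ 𝟘 , y) refl refl (m ×ᴿ x ∷ []))
⊖-· zero    (suc n) x = ≈-trans
  (+-mono-≈ (≈-trans (neg-def _) (≈-reflexive (cong (0ℝ -ᴿ_) (×ᴿ-def (suc n) x)))) ≈-refl)
  (equation 1 (λ y → 𝟘 ⊝ y ⊕ y , 𝟘) refl refl (suc n ×ᴿ x ∷ []))
⊖-· (suc m) (suc n) x = ≈-trans
  (+-mono-≈ (≈-reflexive (cong (_· x) (ℤ.[1+m]⊖[1+n]≡m⊖n m n))) ≈-refl)
  (≈-trans (equation 3 (λ z x y → z ⊕ (x ⊕ y) , x ⊕ (z ⊕ y)) refl refl ((m ⊖ n) · x ∷ x ∷ n ×ᴿ x ∷ []))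
    (+-mono-≈ ≈-refl (⊖-· m n x)))

-- Twice the cyclomatic number is 2(E + 1) - 2V. As a difference of naturals the coefficient is in
-- the form that `⊖-·` handles.
coefficient : ∀ V E l → + 2 *ℤ (+ E ℤ.- + V +ℤ + 1) +ℤ + l ≡ ((suc E ℕ.+ suc E) ℕ.+ l) ⊖ (V ℕ.+ V)
coefficient V E l = trans (ring (+ E) (+ V) (+ l)) (ℤ.[+m]-[+n]≡m⊖n (suc E ℕ.+ suc E ℕ.+ l) (V ℕ.+ V))
  where
  ring : ∀ E V l → + 2 *ℤ (E ℤ.- V +ℤ + 1) +ℤ l ≡ ((+ 1 +ℤ E) +ℤ (+ 1 +ℤ E) +ℤ l) ℤ.- (V +ℤ V)
  ring = Z.solve 3 (λ E V l → Z.con (+ 2) Z.:* (E Z.:- V Z.:+ Z.con (+ 1)) Z.:+ l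
    Z.:= ((Z.con (+ 1) Z.:+ E) Z.:+ (Z.con (+ 1) Z.:+ E) Z.:+ l) Z.:- (V Z.:+ V)) refl

total-length-bound : ∀ G r → let open MetricGraph G in
  ∣V∣ ×ᴿ (r +ᴿ r) +ᴿ Σᴿ len ⊑ suc ∣E∣ ×ᴿ (r +ᴿ r) +ᴿ leaves G ×ᴿ r →
  totalLength G ≤ (+ 2 *ℤ cyc G +ℤ + leaves G) · r
total-length-bound G r bound = subst₂ (λ z x → x ≤ z · r)
  (sym (coefficient ∣V∣ ∣E∣ (leaves G))) (sym (Σᴿ-def len))
  (⊑⇒≤ (linear 7
    (λ v c e l z u w → (v ⊕ c ≼ e ⊕ l) ∷ (u ≼ v) ∷ (e ⊕ l ≼ w) ∷ (w ≼ z ⊕ u) ∷ [] ⊢ c ≼ z)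
    refl (∣V∣ ×ᴿ (r +ᴿ r) ∷ Σᴿ len ∷ suc ∣E∣ ×ᴿ (r +ᴿ r) ∷ leaves G ×ᴿ r ∷ (m ⊖ n) · r ∷ n ×ᴿ r ∷ m ×ᴿ r ∷ [])
    ( bound , ≈⇒⊒ (double ∣V∣)
    , ≈⇒⊑ (≈-trans (+-mono-≈ (double (suc ∣E∣)) ≈-refl) (≈-sym (×ᴿ-homo-+ r (suc ∣E∣ ℕ.+ suc ∣E∣) (leaves G))))
    , ≈⇒⊒ (⊖-· m n r) , tt)))
  where
  open MetricGraph G
  m n : ℕ
  m = suc ∣E∣ ℕ.+ suc ∣E∣ ℕ.+ leaves G
  n = ∣V∣ ℕ.+ ∣V∣
  double : ∀ k → k ×ᴿ (r +ᴿ r) ≈ (k ℕ.+ k) ×ᴿ r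
  double k = ≈-trans (×ᴿ-distrib-+ r r k) (≈-sym (×ᴿ-homo-+ r k k))

-- Placing the centre on an edge, and the edgeless graph

0+≃ : ∀ x y → x ≃ y → 0ℝ + x ≃ y
0+≃ x y x≃y = subst (_≃ y) (sym (+ᴿ-def 0ℝ x))
  (≈⇒≃ (≈-trans (equation 1 (λ x → 𝟘 ⊕ x , x) refl refl (x ∷ [])) (≃⇒≈ {x} {y} x≃y)))

module _ (G : MetricGraph) where
  open MetricGraph G

  distance-glue : ∀ {p q y d} (s : Step G p q) → stepLength G s ≡ 0ℝ →
    IsDistance G p y d → IsDistance G q y d
  distance-glue {d = d} s s≡0 ((π , π≃d) , low) =
    (bwd s ◅ π , subst (λ x → x + pathLength G π ≃ d) (sym s≡0) (0+≃ (pathLength G π) d π≃d)) ,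
    λ z (ρ , ρ≃z) → low z (fwd s ◅ ρ , subst (λ x → x + pathLength G ρ ≃ z) (sym s≡0) (0+≃ (pathLength G ρ) z ρ≃z))

  -- If there is an edge at all, connectedness gives every vertex an incident one, and the vertex is
  -- glued to an end of it. Distances pass from the edge point to `x`, so a bound on those from `x`
  -- also holds for those from the edge point.
  on-edge : ∀ x → ∣E∣ ≡ 0 ⊎ (∃[ e ] ∃[ t ] Σ (0ℝ ≤ t) λ t≥0 → Σ (t ≤ len e) λ t≤len →
    ∀ y d → IsDistance G (on e t t≥0 t≤len) y d → IsDistance G x y d)
  on-edge (on e t t≥0 t≤len) = inj₂ (e , t , t≥0 , t≤len , λ _ _ → id)
  on-edge (vertex v) = [ inj₁ , (λ e → inj₂ (glued (incident-edge e (connected v (src e))))) ]′ (empty? ∣E∣)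
    where
    empty? : ∀ n → n ≡ 0 ⊎ Fin n
    empty? zero    = inj₁ refl
    empty? (suc n) = inj₂ zero
    incident-edge : ∀ {v} e → EqClosure (λ a b → ∃[ e ] src e ≡ a × tgt e ≡ b) v (src e) →
      (∃[ e ] src e ≡ v) ⊎ (∃[ e ] tgt e ≡ v)
    incident-edge e ε                     = inj₁ (e , refl)
    incident-edge _ (fwd (e , eq , _) ◅ _) = inj₁ (e , eq)
    incident-edge _ (bwd (e , _ , eq) ◅ _) = inj₂ (e , eq)
    0≤len : ∀ e → 0ℝ ≤ len e
    0≤len e = ⊑⇒≤ (<⇒⊑ {0ℝ} {len e} (len>0 e))
    glued : ∀ {v} → (∃[ e ] src e ≡ v) ⊎ (∃[ e ] tgt e ≡ v) →
      ∃[ e ] ∃[ t ] Σ (0ℝ ≤ t) λ t≥0 → Σ (t ≤ len e) λ t≤len →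
        ∀ y d → IsDistance G (on e t t≥0 t≤len) y d → IsDistance G (vertex v) y d
    glued (inj₁ (e , refl)) = e , 0ℝ , ≤-refl 0ℝ , 0≤len e ,
      λ _ d → distance-glue {d = d} (glue-src e 0ℝ (≃-refl 0ℝ)) refl
    glued (inj₂ (e , refl)) = e , len e , 0≤len e , ≤-refl (len e) ,
      λ _ d → distance-glue {d = d} (glue-tgt e (len e) (≃-refl (len e))) refl

  single-vertex : ∣E∣ ≡ 0 → ∣V∣ ≡ 1
  single-vertex E≡0 = single ∣V∣ (ℕ.>-nonZero⁻¹ ∣V∣ {{nonempty}}) λ u v → equal (connected u v)
    where
    no-edge : ∀ {n} → n ≡ 0 → ¬ Fin n
    no-edge refl ()
    equal : ∀ {u v} → EqClosure (λ a b → ∃[ e ] src e ≡ a × tgt e ≡ b) u v → u ≡ v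
    equal ε                 = refl
    equal (fwd (e , _) ◅ _) = contradiction e (no-edge E≡0)
    equal (bwd (e , _) ◅ _) = contradiction e (no-edge E≡0)
    single : ∀ n → 0 ℕ.< n → (∀ (u v : Fin n) → u ≡ v) → n ≡ 1
    single 1             _ _   = refl
    single (suc (suc n)) _ all = contradiction (all zero (suc zero)) λ ()

  -- Here `∣V∣` and `suc ∣E∣` are both one, and the total length is an empty sum.
  no-edges-bound : ∀ {r} → 0ℝ ⊑ r → ∣E∣ ≡ 0 →
    ∣V∣ ×ᴿ (r +ᴿ r) +ᴿ Σᴿ len ⊑ suc ∣E∣ ×ᴿ (r +ᴿ r) +ᴿ leaves G ×ᴿ r
  no-edges-bound {r} 0⊑r E≡0 = bound (single-vertex E≡0) E≡0 len (multiple-nonneg (leaves G) 0⊑r)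
    where
    bound : ∀ {V E x y} → V ≡ 1 → E ≡ 0 → (f : Fin E → ℝ) → 0ℝ ⊑ y → V ×ᴿ x +ᴿ Σᴿ f ⊑ suc E ×ᴿ x +ᴿ y
    bound refl refl f 0⊑y = +-mono-⊑ ⊑-refl 0⊑y

  -- The bound is an inequality between reals, hence stable, so shortest walks to all vertices may
  -- be assumed.
  rooted-bound : ∀ {r} e₀ t₀ t₀≥0 t₀≤len → (∀ y d → IsDistance G (on e₀ t₀ t₀≥0 t₀≤len) y d → d ≤ r) →
    ∣V∣ ×ᴿ (r +ᴿ r) +ᴿ Σᴿ len ⊑ suc ∣E∣ ×ᴿ (r +ᴿ r) +ᴿ leaves G ×ᴿ r
  rooted-bound {r} e₀ t₀ t₀≥0 t₀≤len bounded = ⊑-stable (¬¬-map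
    (λ minima → Potential.length-bound G e₀ t₀ ⟨ t₀≥0 ⟩ ⟨ t₀≤len ⟩ minima r bounded)
    (Rooted.minimal-walks G e₀ t₀ ⟨ t₀≥0 ⟩ ⟨ t₀≤len ⟩))

theorem1 : (G : MetricGraph) (radius : ℝ) → IsRadius G radius →
    totalLength G ≤ (+ 2 *ℤ cyc G +ℤ + leaves G) · radius
theorem1 G radius ((x , (y , (π , π≃r) , _) , bounded) , _) = total-length-bound G radius
  -- The radius is nonnegative because it is the length of the path `π`.
  ([ no-edges-bound G (⊑-trans (length-nonneg π) (subst (_⊑ radius) (length-def π) ⟨ proj₁ π≃r ⟩))
   , (λ (e₀ , t₀ , t₀≥0 , t₀≤len , transfer) →
        rooted-bound G e₀ t₀ t₀≥0 t₀≤len λ q d isDistance → bounded d (q , transfer q d isDistance))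
   ]′ (on-edge G x))
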